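{- Let $r\ge1$ be an integer and $x_1,\dots,x_r,y$ indeterminates. Then for every $n\ge0$, $$L_n(\boldsymbol{e}(x_1,\dots,x_r),y)=S^{(r)}_n(\boldsymbol{\alpha}),$$ where $\boldsymbol{\alpha}=(\alpha_i)_{i\ge r}=(y,x_1,\dots,x_r,\,y,2x_1,\dots,2x_r,\,y,3x_1,\dots,3x_r,\dots)$; explicitly, for $i\ge r$, $\alpha_i=y$ if $i\equiv r \pmod{r+1}$, and $\alpha_i=\lfloor i/(r+1)\rfloor\, x_{j+1}$ if $i\equiv j\pmod{r+1}$ with $0\le j\le r-1$.
   Context: $\boldsymbol{e}(x_1,\dots,x_r)=(e_n(x_1,\dots,x_r))_{n\ge0}$ are the elementary symmetric polynomials ($e_0=1$, $e_n=0$ for $n>r$). Generic Lah polynomials: an ordered tree is a rooted tree in which the children of each vertex are linearly ordered; an increasing ordered tree on a finite set of integers is an ordered tree bijectively labeled by that set so that every child has larger label than its parent. For $\boldsymbol{\phi}=(\phi_i)_{i\ge0}$, $L_{n,k}(\boldsymbol{\phi})$ is the sum over unordered forests of $k$ increasing ordered trees whose vertex sets partition $[n]$ of $\prod_v\phi_{\deg(v)}$ ($\deg(v)$ = number of children; $L_{0,0}=1$), and $L_n(\boldsymbol{\phi},y)=\sum_{k=0}^nL_{n,k}(\boldsymbol{\phi})y^k$. $m$-Stieltjes–Rogers polynomials: for an integer $m\ge1$, an $m$-Dyck path of length $(m+1)n$ is a path in $\mathbb{Z}\times\mathbb{N}$ from $(0,0)$ to $((m+1)n,0)$ using steps $(1,1)$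 (rises) and $(1,-m)$ ($m$-falls). Given $\boldsymbol{\alpha}=(\alpha_i)_{i\ge m}$, $S^{(m)}_n(\boldsymbol{\alpha})$ is the sum over all such paths of the product of weights, where each rise has weight $1$ and each $m$-fall starting at height $i$ has weight $\alpha_i$. -}

module Defs where

open import Level using (Level)
open import Algebra.Bundles using (CommutativeSemiring)
open import Data.Bool using (Bool; true; false; _∧_; _∨_; not; if_then_else_)
open import Data.Nat using (ℕ; zero; suc; _∸_; _≡ᵇ_; _≤ᵇ_; _<ᵇ_; _<?_)
open import Data.Nat.DivMod using (_/_; _%_)
open import Data.Fin using (Fin; toℕ; fromℕ<)
import Data.Fin as F
open import Data.Product using (_×_; _,_)
open import Data.Maybe using (Maybe; just; nothing)
open import Data.List using (List; []; _∷_; map; concatMap; allFin; filter; length; foldr)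
open import Data.Bool.ListAction using (all; any)
import Data.List as L
open import Data.Vec using (Vec; []; _∷_; lookup)
open import Relation.Nullary using (yes; no)
open import Relation.Nullary.Decidable using (⌊_⌋)

allVecs : ∀ {a} {A : Set a} → List A → (n : ℕ) → List (Vec A n)
allVecs xs zero    = [] ∷ []
allVecs xs (suc n) = concatMap (λ x → map (x ∷_) (allVecs xs n)) xs

count : ∀ {a} {A : Set a} → (A → Bool) → List A → ℕ
count p xs = length (filter (λ x → Data.Bool.T? (p x)) xs)
  where import Data.Bool

finEq : ∀ {n} → Fin n → Fin n → Bool
finEq i j = ⌊ i F.≟ j ⌋

isJust≡ : ∀ {n} → Maybe (Fin n) → Fin n → Bool
isJust≡ nothing  u = false
isJust≡ (just w) u = finEq w u

isNothing : ∀ {a} {A : Set a} → Maybe A → Bool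
isNothing nothing  = true
isNothing (just _) = false

module _ {c ℓ} (R : CommutativeSemiring c ℓ) where
  open CommutativeSemiring R

  ΣL : ∀ {a} {A : Set a} → List A → (A → Carrier) → Carrier
  ΣL xs f = foldr (λ x acc → f x + acc) 0# xs

  ΠL : ∀ {a} {A : Set a} → List A → (A → Carrier) → Carrier
  ΠL xs f = foldr (λ x acc → f x * acc) 1# xs

  pow : Carrier → ℕ → Carrier
  pow x zero    = 1#
  pow x (suc k) = x * pow x k

  _·_ : ℕ → Carrier → Carrier
  zero  · x = 0#
  suc k · x = x + k · x

  elem : (r : ℕ) → (Fin r → Carrier) → ℕ → Carrier
  elem r x k =
    ΣL (filter (λ S → Data.Bool.T? (count (λ i → lookup S i) (allFin r) ≡ᵇ k))
               (allVecs (true ∷ false ∷ []) r))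
       (λ S → ΠL (allFin r) (λ i → if lookup S i then x i else 1#))
    where import Data.Bool

  -- Increasing ordered forests on [n] (vertices labelled by Fin n;
  -- label i stands for i+1, so the order is preserved).
  -- A forest is encoded by
  --   par : Vec (Maybe (Fin n)) n   -- parent of each vertex (nothing = root)
  --   rk  : Vec (Fin n) n           -- position of a vertex among its
  --                                    parent's children (0-based)
  -- subject to:
  --   * increasing: every child has larger label than its parent;
  --   * roots carry rank 0 (roots are unordered: the forest is unordered);
  --   * for each vertex u, the rank map restricted to the children of u
  --     is a bijection onto {0, ..., deg u - 1}  (a linear order on the
  --     children of u).
  -- These data are in bijection with unordered forests of increasing
  -- ordered trees whose vertex sets partition [n].

  module _ (n : ℕ) (par : Vec (Maybe (Fin n)) n) (rk : Vec (Fin n) n) where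

    deg : Fin n → ℕ
    deg u = count (λ v → isJust≡ (lookup par v) u) (allFin n)

    numRoots : ℕ
    numRoots = count (λ v → isNothing (lookup par v)) (allFin n)

    increasing : Bool
    increasing = all (λ v → all (λ u → not (isJust≡ (lookup par v) u) ∨ (toℕ u <ᵇ toℕ v))
                                (allFin n)) (allFin n)

    rootsRank0 : Bool
    rootsRank0 = all (λ v → not (isNothing (lookup par v)) ∨ (toℕ (lookup rk v) ≡ᵇ 0)) (allFin n)

    ranksBounded : Bool
    ranksBounded = all (λ v → all (λ u → not (isJust≡ (lookup par v) u)
                                          ∨ (toℕ (lookup rk v) <ᵇ deg u))
                                  (allFin n)) (allFin n)

    ranksInjective : Bool
    ranksInjective =
      all (λ u → all (λ v → all (λ w →
            not (isJust≡ (lookup par v) u ∧ isJust≡ (lookup par w) u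
                 ∧ finEq (lookup rk v) (lookup rk w)) ∨ finEq v w)
          (allFin n)) (allFin n)) (allFin n)

    ranksSurjective : Bool
    ranksSurjective =
      all (λ u → all (λ j → not (toℕ j <ᵇ deg u) ∨
                   any (λ v → isJust≡ (lookup par v) u ∧ finEq (lookup rk v) j) (allFin n))
                 (allFin n)) (allFin n)

    isForest : Bool
    isForest = increasing ∧ rootsRank0 ∧ ranksBounded ∧ ranksInjective ∧ ranksSurjective

    forestWeight : (ℕ → Carrier) → Carrier → Carrier
    forestWeight φ y = pow y numRoots * ΠL (allFin n) (λ v → φ (deg v))

  allForestData : (n : ℕ) → List (Vec (Maybe (Fin n)) n × Vec (Fin n) n)
  allForestData n =
    concatMap (λ p → map (λ q → p , q) (allVecs (allFin n) n))
              (allVecs (nothing ∷ map just (allFin n)) n)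


  lah : (ℕ → Carrier) → Carrier → ℕ → Carrier
  lah φ y n = ΣL (allForestData n) λ { (p , q) →
                 if isForest n p q then forestWeight n p q φ y else 0# }

  -- m-Dyck paths: sequences of steps rise (1,1) / m-fall (1,-m),
  -- length (m+1)n, staying at height ≥ 0 and ending at height 0.
  -- true = rise, false = m-fall.

  validFrom : ℕ → ℕ → List Bool → Bool
  validFrom m h []            = h ≡ᵇ 0
  validFrom m h (true  ∷ s)   = validFrom m (suc h) s
  validFrom m h (false ∷ s)   = (m ≤ᵇ h) ∧ validFrom m (h ∸ m) s

  weightFrom : ℕ → (ℕ → Carrier) → ℕ → List Bool → Carrier
  weightFrom m α h []          = 1#
  weightFrom m α h (true  ∷ s) = weightFrom m α (suc h) s
  weightFrom m α h (false ∷ s) = α h * weightFrom m α (h ∸ m) s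

  -- m-Stieltjes–Rogers polynomial S^{(m)}_n(α); α is indexed by ℕ but
  -- only the values α_i with i ≥ m are ever used.
  stieltjesRogers : (m : ℕ) → (ℕ → Carrier) → ℕ → Carrier
  stieltjesRogers m α n =
    ΣL (allVecs (true ∷ false ∷ []) (suc m Data.Nat.* n)) λ v →
      if validFrom m 0 (Data.Vec.toList v)
        then weightFrom m α 0 (Data.Vec.toList v) else 0#
    where import Data.Nat; import Data.Vec

  -- α_i = y                 if i ≡ r (mod r+1)
  --     = ⌊i/(r+1)⌋ x_{j+1} if i ≡ j (mod r+1), 0 ≤ j ≤ r-1
  -- (x_{j+1} is x (j) with 0-based Fin indexing.)
  alphaSeq : (r : ℕ) → (Fin r → Carrier) → Carrier → ℕ → Carrier
  alphaSeq r x y i with i % suc r <? r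
  ... | yes j<r = (i / suc r) · x (fromℕ< j<r)
  ... | no  _   = y

{-# OPTIONS --safe #-}

-- Both sides are iterates of the same operator. On the Dyck side every step raises the height by 1
-- modulo r + 1, so with zᵏ standing for height k (r + 1) a block of r + 1 steps acts on polynomials as
-- (z + y) Π (1 + x_i d/dz), and S_n is the constant term of the n-th iterate at 1. On the forest side,
-- adding a new smallest vertex that takes d of the existing roots as ordered children is
-- z e_d(x) (d/dz)ᵈ with z marking roots, so L_n is the value at z = y of the n-th iterate of
-- z Π (1 + x_i d/dz) at 1. The two operators are conjugate under z ↦ z + y.
-- All operators appear below in dual form, acting on functions k ↦ V k of the exponent of z.
module Submission where

open import Defs
open import Algebra.Bundles using (CommutativeSemiring)
open import Data.Bool using (Bool; true; false; _∧_; _∨_; not; if_then_else_; T; T?)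
open import Data.Bool.ListAction using (all; any)
open import Data.Bool.Properties using (T-≡; T-∧)
open import Data.Empty using (⊥-elim)
open import Data.Fin as Fin using (Fin; zero; suc; toℕ)
import Data.Fin.Properties as Finₚ
open import Data.List using (List; []; _∷_; _++_; _∷ʳ_; allFin; concatMap; filter; map; replicate; tabulate)
open import Data.List.Properties using (∷ʳ-++; ++-assoc; ++-identityʳ)
open import Data.List.Relation.Unary.All as All using (All; []; _∷_)
import Data.List.Relation.Unary.All.Properties as Allₚ
open import Data.Maybe using (Maybe; just; nothing)
open import Data.Nat as ℕ using (ℕ; zero; suc; pred; _∸_; _/_; _%_; _<?_; _≡ᵇ_; _<ᵇ_; _≤ᵇ_; _≥_)
open import Data.Nat.DivMod using ([m+kn]%n≡m%n; m<n⇒m%n≡m; m<n⇒m/n≡0; m*n/n≡m; +-distrib-/-∣ʳ)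
open import Data.Nat.Divisibility using (divides-refl)
import Data.Nat.Properties as ℕₚ
open import Data.Nat.Solver using (module +-*-Solver)
open import Data.Product using (_×_; _,_; proj₁; proj₂; ∃)
open import Data.Unit using (tt)
open import Data.Vec as Vec using (Vec; []; _∷_; lookup)
open import Function using (_∘_; case_of_; Equivalence)
open import Relation.Binary.PropositionalEquality as ≡ using (_≡_; _≢_)
open import Relation.Nullary using (¬_; yes; no)
open import Relation.Nullary.Decidable using (toWitness; fromWitness)

-- Booleans and counting

-- The obstacle is a change of viewpoint: the encoding lets every vertex choose its parent, in
-- increasing order of labels, while the operator lets every vertex choose its children among the
-- roots present. To exchange the two, forests are generalised to `n` inner vertices with `m`
-- further labelled leaves, which stand for trees already built on larger labels. When the largest
-- inner vertex is peeled off, it and the leaves it did not take become the leaves over the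
-- remaining vertices. The factorials come from the linear orders: a vertex with `d` children has
-- `d!` of them, and its set of children is one of binomially many `d`-subsets of the `m` roots. The
-- product of the two numbers is `m (m - 1) ... (m - d + 1)`, the coefficient produced by the `d`-th
-- derivative of `zᵐ`. The carrier is only a commutative semiring, so neither division by factorials
-- nor the substitution `z ↦ z - y` is available. Hence weights are kept as `d! e_d(x)`, and the
-- forest values are expressed as translates of the path values rather than conversely.

count-tabulate : ∀ {a} {A : Set a} {n} (g : Fin n → A) p → count p (tabulate g) ≡ count (p ∘ g) (allFin n)
count-tabulate {n = zero}  g p = ≡.refl
count-tabulate {n = suc n} g p with p (g zero)
... | true  = ≡.cong suc (≡.trans (count-tabulate (g ∘ suc) p) (≡.sym (count-tabulate suc (p ∘ g))))
... | false = ≡.trans (count-tabulate (g ∘ suc) p) (≡.sym (count-tabulate suc (p ∘ g)))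

≤⇒≤ᵇ≡true : ∀ {m n} → m ℕ.≤ n → (m ≤ᵇ n) ≡ true
≤⇒≤ᵇ≡true p = Equivalence.to T-≡ (ℕₚ.≤⇒≤ᵇ p)

>⇒≤ᵇ≡false : ∀ {m n} → n ℕ.< m → (m ≤ᵇ n) ≡ false
>⇒≤ᵇ≡false {m} {n} n<m with m ≤ᵇ n in eq
... | false = ≡.refl
... | true  = ⊥-elim (ℕₚ.<⇒≱ n<m (ℕₚ.≤ᵇ⇒≤ m n (Equivalence.from T-≡ eq)))

remainder-< : ∀ {j r} → j ℕ.< suc r → ∀ k → (j ℕ.+ k ℕ.* suc r) % suc r ≡ j
remainder-< {j} {r} j<1+r k = ≡.trans ([m+kn]%n≡m%n j k (suc r)) (m<n⇒m%n≡m j<1+r)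

≡ᵇ-refl : ∀ n → (n ≡ᵇ n) ≡ true
≡ᵇ-refl n = Equivalence.to T-≡ (ℕₚ.≡⇒≡ᵇ n n ≡.refl)

≢⇒≡ᵇ≡false : ∀ {m n} → m ≢ n → (m ≡ᵇ n) ≡ false
≢⇒≡ᵇ≡false {m} {n} m≢n with m ≡ᵇ n in eq
... | false = ≡.refl
... | true  = ⊥-elim (m≢n (ℕₚ.≡ᵇ⇒≡ m n (Equivalence.from T-≡ eq)))

<⇒<ᵇ≡true : ∀ {m n} → m ℕ.< n → (m <ᵇ n) ≡ true
<⇒<ᵇ≡true p = Equivalence.to T-≡ (ℕₚ.<⇒<ᵇ p)

≥⇒<ᵇ≡false : ∀ {m n} → n ℕ.≤ m → (m <ᵇ n) ≡ false
≥⇒<ᵇ≡false {m} {n} n≤m with m <ᵇ n in eq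
... | false = ≡.refl
... | true  = ⊥-elim (ℕₚ.<⇒≱ (ℕₚ.<ᵇ⇒< m n (Equivalence.from T-≡ eq)) n≤m)

bump : ℕ → (ℕ → ℕ) → ℕ → ℕ
bump u d w = if w ≡ᵇ u then suc (d w) else d w

bump-self : ∀ u d → bump u d u ≡ suc (d u)
bump-self u d rewrite ≡ᵇ-refl u = ≡.refl

bump-other : ∀ {u w} d → w ≢ u → bump u d w ≡ d w
bump-other d w≢u rewrite ≢⇒≡ᵇ≡false w≢u = ≡.refl

bump-cong : ∀ u {d e} w → d w ≡ e w → bump u d w ≡ bump u e w
bump-cong u w eq with w ≡ᵇ u
... | true  = ≡.cong suc eq
... | false = eq

bump-comm : ∀ u v d w → bump u (bump v d) w ≡ bump v (bump u d) w
bump-comm u v d w with w ≡ᵇ u | w ≡ᵇ v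
... | true  | true  = ≡.refl
... | true  | false = ≡.refl
... | false | true  = ≡.refl
... | false | false = ≡.refl

-- Lists of bounds on the possible parents

-- Bounds on the parents of n inner vertices, in increasing order, followed by a leaves.
parentBounds : ℕ → ℕ → List ℕ
parentBounds zero    zero    = []
parentBounds (suc n) zero    = parentBounds n 1
parentBounds n       (suc a) = parentBounds n a ∷ʳ n

parentBounds-≤ : ∀ n a → All (ℕ._≤ n) (parentBounds n a)
parentBounds-≤ zero    zero    = []
parentBounds-≤ (suc n) zero    = All.map ℕₚ.m≤n⇒m≤1+n (parentBounds-≤ n 1)
parentBounds-≤ zero    (suc a) = Allₚ.∷ʳ⁺ (parentBounds-≤ zero a) ℕₚ.≤-refl
parentBounds-≤ (suc n) (suc a) = Allₚ.∷ʳ⁺ (parentBounds-≤ (suc n) a) ℕₚ.≤-refl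

parentBounds-suc : ∀ n a → parentBounds n (suc a) ≡ parentBounds n a ∷ʳ n
parentBounds-suc zero    a = ≡.refl
parentBounds-suc (suc n) a = ≡.refl

replicate-∷ʳ : ∀ {a} {A : Set a} n (x : A) → replicate n x ∷ʳ x ≡ replicate (suc n) x
replicate-∷ʳ zero    x = ≡.refl
replicate-∷ʳ (suc n) x = ≡.cong (x ∷_) (replicate-∷ʳ n x)

-- With no leaves left, the largest of the `suc n` inner vertices acts as a single leaf over the
-- other `n`. This isolates the final block of leaves, the only vertices that can choose it as
-- parent.
parentBounds-leaves : ∀ n a → parentBounds (suc n) a ≡ parentBounds n 1 ++ replicate a (suc n)
parentBounds-leaves n zero    = ≡.sym (++-identityʳ _)
parentBounds-leaves n (suc a) = ≡.trans (≡.cong (_∷ʳ suc n) (parentBounds-leaves n a))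
  (≡.trans (++-assoc (parentBounds n 1) _ _) (≡.cong (parentBounds n 1 ++_) (replicate-∷ʳ a (suc n))))

parentBounds-zero : ∀ a → parentBounds 0 a ≡ replicate a 0
parentBounds-zero zero    = ≡.refl
parentBounds-zero (suc a) = ≡.trans (≡.cong (_∷ʳ 0) (parentBounds-zero a)) (replicate-∷ʳ a 0)

range : ℕ → ℕ → List ℕ
range t zero    = []
range t (suc m) = t ∷ range (suc t) m

range-∷ʳ : ∀ t m → range t (suc m) ≡ range t m ∷ʳ (t ℕ.+ m)
range-∷ʳ t zero    = ≡.cong (_∷ []) (≡.sym (ℕₚ.+-identityʳ t))
range-∷ʳ t (suc m) = ≡.cong (t ∷_) (≡.trans (range-∷ʳ (suc t) m)
    (≡.cong (range (suc t) m ∷ʳ_) (≡.sym (ℕₚ.+-suc t m))))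

-- `range` grows at the front, as a parent vector is read, and `parentBounds` at the back, where the
-- largest vertex is peeled off; both list `0, ..., n - 1`.
range-parentBounds : ∀ n → range 0 n ≡ parentBounds n 0
range-parentBounds zero    = ≡.refl
range-parentBounds (suc n) = ≡.trans (range-∷ʳ 0 n)
    (≡.trans (≡.cong (_∷ʳ n) (range-parentBounds n)) (≡.sym (parentBounds-suc n 0)))

-- Parent vectors and their statistics

Parents : ℕ → ℕ → Set
Parents n m = Vec (Maybe (Fin n)) m

roots : ∀ {n m} → Parents n m → ℕ
roots []            = 0
roots (nothing ∷ p) = suc (roots p)
roots (just _  ∷ p) = roots p

-- Vertices are natural numbers here instead of elements of `Fin n`, so that the number of vertices
-- can shrink in an induction while the degree function stays the same.
degree : ∀ {n m} → Parents n m → ℕ → ℕ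
degree []            = λ _ → 0
degree (nothing ∷ p) = degree p
degree (just u  ∷ p) = bump (toℕ u) (degree p)

-- The i-th entry of p is the parent of vertex t + i.
increasingFrom : ∀ {n m} → ℕ → Parents n m → Bool
increasingFrom t []            = true
increasingFrom t (nothing ∷ p) = increasingFrom (suc t) p
increasingFrom t (just u  ∷ p) = (toℕ u <ᵇ t) ∧ increasingFrom (suc t) p

-- Reflection of the boolean conditions

T-ext : ∀ {a b} → (T a → T b) → (T b → T a) → a ≡ b
T-ext {false} {false} f g = ≡.refl
T-ext {false} {true}  f g = ⊥-elim (g tt)
T-ext {true}  {false} f g = ⊥-elim (f tt)
T-ext {true}  {true}  f g = ≡.refl

T-∧⁺ : ∀ {a b} → T a → T b → T (a ∧ b)
T-∧⁺ p q = Equivalence.from T-∧ (p , q)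

T-∧⁻ : ∀ {a b} → T (a ∧ b) → T a × T b
T-∧⁻ = Equivalence.to T-∧

T-⇒⁺ : ∀ {a b} → (T a → T b) → T (not a ∨ b)
T-⇒⁺ {false} f = tt
T-⇒⁺ {true}  f = f tt

T-⇒⁻ : ∀ {a b} → T (not a ∨ b) → T a → T b
T-⇒⁻ {true} p _ = p

finEq⁻ : ∀ {n} {i j : Fin n} → T (finEq i j) → i ≡ j
finEq⁻ = toWitness

finEq⁺ : ∀ {n} {i j : Fin n} → i ≡ j → T (finEq i j)
finEq⁺ = fromWitness

isJust≡⁻ : ∀ {n} {x : Maybe (Fin n)} {u} → T (isJust≡ x u) → x ≡ just u
isJust≡⁻ {x = just w} p = ≡.cong just (finEq⁻ p)

isJust≡⁺ : ∀ {n} {x : Maybe (Fin n)} {u} → x ≡ just u → T (isJust≡ x u)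
isJust≡⁺ ≡.refl = finEq⁺ ≡.refl

isNothing⁻ : ∀ {a} {A : Set a} {x : Maybe A} → T (isNothing x) → x ≡ nothing
isNothing⁻ {x = nothing} p = ≡.refl

isNothing⁺ : ∀ {a} {A : Set a} {x : Maybe A} → x ≡ nothing → T (isNothing x)
isNothing⁺ ≡.refl = tt

finEq-≡ᵇ : ∀ {n} (w u : Fin n) → finEq w u ≡ (toℕ u ≡ᵇ toℕ w)
finEq-≡ᵇ w u = T-ext (λ p → ℕₚ.≡⇒≡ᵇ _ _ (≡.cong toℕ (≡.sym (finEq⁻ p))))
                     (λ p → finEq⁺ (≡.sym (Finₚ.toℕ-injective (ℕₚ.≡ᵇ⇒≡ _ _ p))))

all-tabulate : ∀ {a} {A : Set a} {n} (g : Fin n → A) p → all p (tabulate g) ≡ all (p ∘ g) (allFin n)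
all-tabulate {n = zero}  g p = ≡.refl
all-tabulate {n = suc n} g p = ≡.cong (p (g zero) ∧_)
  (≡.trans (all-tabulate (g ∘ suc) p) (≡.sym (all-tabulate Fin.suc (p ∘ g))))

any-tabulate : ∀ {a} {A : Set a} {n} (g : Fin n → A) p → any p (tabulate g) ≡ any (p ∘ g) (allFin n)
any-tabulate {n = zero}  g p = ≡.refl
any-tabulate {n = suc n} g p = ≡.cong (p (g zero) ∨_)
  (≡.trans (any-tabulate (g ∘ suc) p) (≡.sym (any-tabulate Fin.suc (p ∘ g))))

all-allFin⁺ : ∀ {n} {p : Fin n → Bool} → (∀ i → T (p i)) → T (all p (allFin n))
all-allFin⁺ {zero}      f = tt
all-allFin⁺ {suc n} {p} f = T-∧⁺ (f zero) (≡.subst T (≡.sym (all-tabulate Fin.suc p)) (all-allFin⁺ (f ∘ suc)))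

all-allFin⁻ : ∀ {n} {p : Fin n → Bool} → T (all p (allFin n)) → ∀ i → T (p i)
all-allFin⁻ {suc n} {p} t zero    = proj₁ (T-∧⁻ t)
all-allFin⁻ {suc n} {p} t (suc i) = all-allFin⁻ (≡.subst T (all-tabulate Fin.suc p) (proj₂ (T-∧⁻ {p zero} t))) i

any-allFin⁺ : ∀ {n} {p : Fin n → Bool} i → T (p i) → T (any p (allFin n))
any-allFin⁺ {suc n} {p} zero    t with p zero
... | true = tt
any-allFin⁺ {suc n} {p} (suc i) t with p zero
... | true  = tt
... | false = ≡.subst T (≡.sym (any-tabulate Fin.suc p)) (any-allFin⁺ i t)

count-degree : ∀ {n m} (p : Parents n m) u → count (λ v → isJust≡ (lookup p v) u) (allFin m) ≡ degree p (toℕ u)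
count-degree []            u = ≡.refl
count-degree (nothing ∷ p) u = ≡.trans (count-tabulate Fin.suc (λ v → isJust≡ (lookup (nothing ∷ p) v) u))
    (count-degree p u)
count-degree (just w ∷ p)  u with finEq w u | finEq-≡ᵇ w u
... | true  | eq rewrite ≡.sym eq = ≡.cong suc
    (≡.trans (count-tabulate Fin.suc (λ v → isJust≡ (lookup (just w ∷ p) v) u)) (count-degree p u))
... | false | eq rewrite ≡.sym eq = ≡.trans (count-tabulate Fin.suc (λ v → isJust≡ (lookup (just w ∷ p) v) u))
    (count-degree p u)

count-roots : ∀ {n m} (p : Parents n m) → count (λ v → isNothing (lookup p v)) (allFin m) ≡ roots p
count-roots []            = ≡.refl
count-roots (nothing ∷ p) = ≡.cong suc (≡.trans
    (count-tabulate Fin.suc (λ v → isNothing (lookup (nothing ∷ p) v))) (count-roots p))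
count-roots (just w ∷ p)  = ≡.trans (count-tabulate Fin.suc (λ v → isNothing (lookup (just w ∷ p) v)))
    (count-roots p)

increasingFrom⁻ : ∀ {n m} t (p : Parents n m) → T (increasingFrom t p) →
  ∀ v u → lookup p v ≡ just u → toℕ u ℕ.< t ℕ.+ toℕ v
increasingFrom⁻ t (just w ∷ p)  inc zero _ ≡.refl = ≡.subst (toℕ w ℕ.<_) (≡.sym (ℕₚ.+-identityʳ t))
    (ℕₚ.<ᵇ⇒< _ _ (proj₁ (T-∧⁻ inc)))
increasingFrom⁻ t (nothing ∷ p) inc (suc v) u eq =
  ≡.subst (toℕ u ℕ.<_) (≡.sym (ℕₚ.+-suc t (toℕ v))) (increasingFrom⁻ (suc t) p inc v u eq)
increasingFrom⁻ t (just w ∷ p)  inc (suc v) u eq =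
  ≡.subst (toℕ u ℕ.<_) (≡.sym (ℕₚ.+-suc t (toℕ v)))
      (increasingFrom⁻ (suc t) p (proj₂ (T-∧⁻ {toℕ w <ᵇ t} inc)) v u eq)

increasingFrom⁺ : ∀ {n m} t (p : Parents n m) → (∀ v u → lookup p v ≡ just u → toℕ u ℕ.< t ℕ.+ toℕ v) →
  T (increasingFrom t p)
increasingFrom⁺ t []            inc = tt
increasingFrom⁺ t (nothing ∷ p) inc =
  increasingFrom⁺ (suc t) p (λ v u eq → ≡.subst (toℕ u ℕ.<_) (ℕₚ.+-suc t (toℕ v)) (inc (suc v) u eq))
increasingFrom⁺ t (just w ∷ p)  inc = T-∧⁺
  (ℕₚ.<⇒<ᵇ (≡.subst (toℕ w ℕ.<_) (ℕₚ.+-identityʳ t) (inc zero w ≡.refl)))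
  (increasingFrom⁺ (suc t) p (λ v u eq → ≡.subst (toℕ u ℕ.<_) (ℕₚ.+-suc t (toℕ v)) (inc (suc v) u eq)))

-- Assignment of ranks to children

#< : ℕ → (ℕ → Bool) → ℕ
#< zero    f = 0
#< (suc n) f = (if f n then 1 else 0) ℕ.+ #< n f

#<-cong : ∀ n {f g} → (∀ i → i ℕ.< n → f i ≡ g i) → #< n f ≡ #< n g
#<-cong zero    eq = ≡.refl
#<-cong (suc n) eq = ≡.cong₂ (λ b k → (if b then 1 else 0) ℕ.+ k) (eq n ℕₚ.≤-refl)
    (#<-cong n (λ i i<n → eq i (ℕₚ.m<n⇒m<1+n i<n)))

#<-remove : ∀ n {f g j} → j ℕ.< n → f j ≡ true → g j ≡ false → (∀ i → i ≢ j → g i ≡ f i) → #< n f ≡ suc (#< n g)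
#<-remove (suc n) {f} {g} {j} j<1+n fj gj eq with n ℕ.≟ j
... | yes ≡.refl rewrite fj | gj = ≡.cong suc (#<-cong n (λ i i<n → ≡.sym (eq i (ℕₚ.<⇒≢ i<n))))
... | no n≢j rewrite eq n n≢j =
  ≡.trans (≡.cong ((if f n then 1 else 0) ℕ.+_) (#<-remove n (ℕₚ.≤∧≢⇒< (ℕ.s≤s⁻¹ j<1+n) (n≢j ∘ ≡.sym)) fj gj eq))
      (ℕₚ.+-suc (if f n then 1 else 0) _)

#<-zero : ∀ n {f} → #< n f ≡ 0 → ∀ {i} → i ℕ.< n → ¬ T (f i)
#<-zero (suc n) {f} eq {i} i<1+n fi with n ℕ.≟ i
... | yes ≡.refl with f n
...   | true = case eq of λ ()
#<-zero (suc n) {f} eq {i} i<1+n fi | no n≢i =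
  #<-zero n (ℕₚ.m+n≡0⇒n≡0 (if f n then 1 else 0) eq) (ℕₚ.≤∧≢⇒< (ℕ.s≤s⁻¹ i<1+n) (n≢i ∘ ≡.sym)) fi

#<-<ᵇ : ∀ {n k} → k ℕ.≤ n → #< n (_<ᵇ k) ≡ k
#<-<ᵇ {zero}  {zero} k≤n = ≡.refl
#<-<ᵇ {suc n} {k}    k≤1+n with k ℕ.≟ suc n
... | yes ≡.refl rewrite <⇒<ᵇ≡true (ℕₚ.n<1+n n) = ≡.cong suc
    (≡.trans (#<-cong n (λ i i<n → ≡.trans (<⇒<ᵇ≡true (ℕₚ.m<n⇒m<1+n i<n)) (≡.sym (<⇒<ᵇ≡true i<n))))
        (#<-<ᵇ {n} {n} ℕₚ.≤-refl))
... | no k≢1+n rewrite ≥⇒<ᵇ≡false {n} {k} (ℕ.s≤s⁻¹ (ℕₚ.≤∧≢⇒< k≤1+n k≢1+n)) = #<-<ᵇ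
    (ℕ.s≤s⁻¹ (ℕₚ.≤∧≢⇒< k≤1+n k≢1+n))

-- free u j says that rank j is still available among the children of u.
remove : ℕ → ℕ → (ℕ → ℕ → Bool) → ℕ → ℕ → Bool
remove u j free w i = not ((w ≡ᵇ u) ∧ (i ≡ᵇ j)) ∧ free w i

-- Ranks are handed out in vertex order, each leaving the pool of its parent once used. In this
-- sequential form the assignments can be counted one vertex at a time.
ranked : ∀ {n m} → (ℕ → ℕ → Bool) → Parents n m → Vec (Fin n) m → Bool
ranked free []            []      = true
ranked free (nothing ∷ p) (j ∷ q) = (toℕ j ≡ᵇ 0) ∧ ranked free p q
ranked free (just u  ∷ p) (j ∷ q) = free (toℕ u) (toℕ j) ∧ ranked (remove (toℕ u) (toℕ j) free) p q

record Ranked {n m} (free : ℕ → ℕ → Bool) (p : Parents n m) (q : Vec (Fin n) m) : Set where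
  field
    rootRank : ∀ v → lookup p v ≡ nothing → toℕ (lookup q v) ≡ 0
    rankFree : ∀ v {u} → lookup p v ≡ just u → T (free (toℕ u) (toℕ (lookup q v)))
    rankInj  : ∀ v w {u} → lookup p v ≡ just u → lookup p w ≡ just u → lookup q v ≡ lookup q w → v ≡ w
open Ranked

remove-free : ∀ u j free w i → T (remove u j free w i) → T (free w i)
remove-free u j free w i t = proj₂ (T-∧⁻ {not ((w ≡ᵇ u) ∧ (i ≡ᵇ j))} t)

remove-self : ∀ u j free → remove u j free u j ≡ false
remove-self u j free rewrite ≡ᵇ-refl u | ≡ᵇ-refl j = ≡.refl

remove-other-rank : ∀ u j free w i → i ≢ j → remove u j free w i ≡ free w i
remove-other-rank u j free w i i≢j rewrite ≢⇒≡ᵇ≡false i≢j with w ≡ᵇ u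
... | true  = ≡.refl
... | false = ≡.refl

remove-other-vertex : ∀ u j free w i → w ≢ u → remove u j free w i ≡ free w i
remove-other-vertex u j free w i w≢u rewrite ≢⇒≡ᵇ≡false w≢u = ≡.refl

ranked⁺ : ∀ {n m} free (p : Parents n m) q → Ranked free p q → T (ranked free p q)
ranked⁺ free []            []      r = tt
ranked⁺ free (nothing ∷ p) (j ∷ q) r = T-∧⁺ (ℕₚ.≡⇒≡ᵇ _ _ (rootRank r zero ≡.refl)) (ranked⁺ free p q record
  { rootRank = λ v → rootRank r (suc v)
  ; rankFree = λ v → rankFree r (suc v)
  ; rankInj  = λ v w a b c → Finₚ.suc-injective (rankInj r (suc v) (suc w) a b c) })
ranked⁺ free (just u ∷ p)  (j ∷ q) r = T-∧⁺ (rankFree r zero ≡.refl) (ranked⁺ _ p q record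
  { rootRank = λ v → rootRank r (suc v)
  ; rankFree = still-free
  ; rankInj  = λ v w a b c → Finₚ.suc-injective (rankInj r (suc v) (suc w) a b c) })
  where
  still-free : ∀ v {w} → lookup p v ≡ just w → T (remove (toℕ u) (toℕ j) free (toℕ w) (toℕ (lookup q v)))
  still-free v {w} pv with toℕ w ℕ.≟ toℕ u | toℕ (lookup q v) ℕ.≟ toℕ j
  ... | no w≢u  | _     = ≡.subst T (≡.sym (remove-other-vertex (toℕ u) (toℕ j) free (toℕ w) _ w≢u))
      (rankFree r (suc v) pv)
  ... | yes _   | no ne = ≡.subst T (≡.sym (remove-other-rank (toℕ u) (toℕ j) free (toℕ w) _ ne))
      (rankFree r (suc v) pv)
  -- A later child of `u` with rank `j` would be identified with the first vertex by injectivity.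
  ... | yes w≡u | yes e = case rankInj r (suc v) zero (≡.trans pv (≡.cong just (Finₚ.toℕ-injective w≡u))) ≡.refl
      (Finₚ.toℕ-injective e) of λ ()

ranked⁻ : ∀ {n m} free (p : Parents n m) q → T (ranked free p q) → Ranked free p q
ranked⁻ free []            []      t = record { rootRank = λ () ; rankFree = λ () ; rankInj = λ () }
ranked⁻ free (nothing ∷ p) (j ∷ q) t = record
  { rootRank = λ { zero _ → ℕₚ.≡ᵇ⇒≡ _ _ (proj₁ (T-∧⁻ t)) ; (suc v) → rootRank r v }
  ; rankFree = λ { (suc v) → rankFree r v }
  ; rankInj  = λ { (suc v) (suc w) a b c → ≡.cong suc (rankInj r v w a b c) } }
  where r = ranked⁻ free p q (proj₂ (T-∧⁻ {toℕ j ≡ᵇ 0} t))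
ranked⁻ free (just u ∷ p)  (j ∷ q) t = record
  { rootRank = λ { (suc v) → rootRank r v }
  ; rankFree = λ { zero ≡.refl → proj₁ (T-∧⁻ t)
                 ; (suc v) {w} pv → remove-free (toℕ u) (toℕ j) free (toℕ w) _ (rankFree r v pv) }
  ; rankInj  = λ { zero zero _ _ _ → ≡.refl
                 ; zero (suc w) ≡.refl b c → ⊥-elim (taken w b (≡.sym c))
                 ; (suc v) zero a ≡.refl c → ⊥-elim (taken v a c)
                 ; (suc v) (suc w) a b c → ≡.cong suc (rankInj r v w a b c) } }
  where
  r = ranked⁻ (remove (toℕ u) (toℕ j) free) p q (proj₂ (T-∧⁻ {free (toℕ u) (toℕ j)} t))
  taken : ∀ v → lookup p v ≡ just u → lookup q v ≢ j
  taken v pv ≡.refl = ≡.subst T (remove-self (toℕ u) (toℕ j) free) (rankFree r v pv)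

-- The invariant of the assignment: the pool of each vertex contains as many ranks as the vertex has
-- children still to come. One step lowers both numbers by one at `u` and changes neither elsewhere.
remove-degree : ∀ n {m} (p : Parents n m) free u j → j ℕ.< n → T (free u j) →
  (∀ w → #< n (free w) ≡ bump u (degree p) w) → ∀ w → #< n (remove u j free w) ≡ degree p w
remove-degree n p free u j j<n fuj eq w with w ℕ.≟ u
... | yes ≡.refl = ℕₚ.suc-injective (≡.trans (≡.sym
    (#<-remove n j<n (Equivalence.to T-≡ fuj) (remove-self u j free)
                     (λ i → remove-other-rank u j free u i))) (≡.trans (eq u) (bump-self u (degree p))))
... | no w≢u = ≡.trans (#<-cong n (λ i _ → remove-other-vertex u j free w i w≢u))
    (≡.trans (eq w) (bump-other (degree p) w≢u))

-- Pigeonhole: by the invariant every pool is empty once all vertices have been read, so a rank that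
-- was free has been taken by some child on the way.
ranked-surjective : ∀ {n m} free (p : Parents n m) q → (∀ w → #< n (free w) ≡ degree p w) → T
    (ranked free p q) →
  ∀ (u j : Fin n) → T (free (toℕ u) (toℕ j)) → ∃ λ v → lookup p v ≡ just u × lookup q v ≡ j
ranked-surjective {n} free [] [] eq t u j f = ⊥-elim (#<-zero n (eq (toℕ u)) (Finₚ.toℕ<n j) f)
ranked-surjective free (nothing ∷ p) (i ∷ q) eq t u j f with ranked-surjective free p q eq
    (proj₂ (T-∧⁻ {toℕ i ≡ᵇ 0} t)) u j f
... | v , a , b = suc v , a , b
ranked-surjective {n} free (just w ∷ p) (i ∷ q) eq t u j f with T-∧⁻ {free (toℕ w)
    (toℕ i)} t | u Fin.≟ w | j Fin.≟ i
... | _        | yes ≡.refl | yes ≡.refl = zero , ≡.refl , ≡.refl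
... | fwi , t′ | yes ≡.refl | no j≢i
  with ranked-surjective _ p q (remove-degree n p free (toℕ w) (toℕ i) (Finₚ.toℕ<n i) fwi eq) t′ u j
         (≡.subst T (≡.sym (remove-other-rank (toℕ w) (toℕ i) free (toℕ u) (toℕ j)
             (j≢i ∘ Finₚ.toℕ-injective))) f)
...   | v , a , b = suc v , a , b
ranked-surjective {n} free (just w ∷ p) (i ∷ q) eq t u j f | fwi , t′ | no u≢w | _
  with ranked-surjective _ p q (remove-degree n p free (toℕ w) (toℕ i) (Finₚ.toℕ<n i) fwi eq) t′ u j
         (≡.subst T (≡.sym (remove-other-vertex (toℕ w) (toℕ i) free (toℕ u) (toℕ j)
             (u≢w ∘ Finₚ.toℕ-injective))) f)
...   | v , a , b = suc v , a , b

degree-≤ : ∀ {n m} (p : Parents n m) u → degree p u ℕ.≤ m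
degree-≤ []            u = ℕ.z≤n
degree-≤ (nothing ∷ p) u = ℕₚ.m≤n⇒m≤1+n (degree-≤ p u)
degree-≤ (just w ∷ p)  u with u ≡ᵇ toℕ w
... | true  = ℕ.s≤s (degree-≤ p u)
... | false = ℕₚ.m≤n⇒m≤1+n (degree-≤ p u)

initial : ∀ {n m} → Parents n m → ℕ → ℕ → Bool
initial p u j = j <ᵇ degree p u

-- The invariant holds at the start: a vertex has at most `n` children, so all ranks below its
-- degree are among the `n` that are counted.
initial-degree : ∀ {n} (p : Parents n n) w → #< n (initial p w) ≡ degree p w
initial-degree p w = #<-<ᵇ (degree-≤ p w)

module _ {c ℓ} (R : CommutativeSemiring c ℓ) where
  open CommutativeSemiring R hiding (zero)
  open import Algebra.Solver.Ring.NaturalCoefficients.Default R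
  open import Relation.Binary.Reasoning.Setoid setoid
  open import Algebra.Properties.CommutativeSemigroup +-commutativeSemigroup
    using () renaming (interchange to +-interchange)
  open import Algebra.Properties.CommutativeSemigroup *-commutativeSemigroup
    using () renaming (x∙yz≈y∙xz to *-swap)

  infixr 8 _⋆_
  _⋆_ : ℕ → Carrier → Carrier
  _⋆_ = _·_ R

  -- Dual operators and their commutation

  Seq : Set c
  Seq = ℕ → Carrier

  -- Dual to the operator 1 + x d/dz on polynomials in z, with V n standing for the image of zⁿ.
  addDerivative : Carrier → Seq → Seq
  addDerivative x V n = V n + (n ⋆ x) * V (pred n)

  addDerivatives : ∀ r → (Fin r → Carrier) → Seq → Seq
  addDerivatives zero    x V = V
  addDerivatives (suc r) x V = addDerivative (x zero) (addDerivatives r (x ∘ suc) V)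

  -- Dual to multiplication by z + y.
  shift+ : Carrier → Seq → Seq
  shift+ y V n = V (suc n) + y * V n

  -- Dual to the substitution z ↦ z + y.
  translate : Carrier → Seq → Seq
  translate y V zero    = V zero
  translate y V (suc n) = translate y (shift+ y V) n

  translate-cong : ∀ y {V W : Seq} → (∀ n → V n ≈ W n) → ∀ n → translate y V n ≈ translate y W n
  translate-cong y eq zero    = eq zero
  translate-cong y eq (suc n) = translate-cong y (λ k → +-cong (eq (suc k)) (*-congˡ (eq k))) n

  translate-linear : ∀ y x (V W : Seq) n →
    translate y (λ k → V k + x * W k) n ≈ translate y V n + x * translate y W n
  translate-linear y x V W zero    = refl
  translate-linear y x V W (suc n) = begin
    translate y (shift+ y (λ k → V k + x * W k)) n
      ≈⟨ translate-cong y (λ k → solve 6 (λ v v′ w w′ a b →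
           (v :+ b :* w) :+ a :* (v′ :+ b :* w′) := (v :+ a :* v′) :+ b :* (w :+ a :* w′)) refl
           (V (suc k)) (V k) (W (suc k)) (W k) y x) n ⟩
    translate y (λ k → shift+ y V k + x * shift+ y W k) n
      ≈⟨ translate-linear y x (shift+ y V) (shift+ y W) n ⟩
    translate y (shift+ y V) n + x * translate y (shift+ y W) n ∎

  -- Dual form of the product rule: moving `1 + x d/dz` past multiplication by `z + y` leaves the
  -- commutator `x`.
  shift+-addDerivative : ∀ y x V n →
    shift+ y (addDerivative x V) n ≈ addDerivative x (shift+ y V) n + x * V n
  shift+-addDerivative y x V zero =
    solve 4 (λ v1 v0 x a → (v1 :+ (x :+ con 0) :* v0) :+ a :* (v0 :+ con 0 :* v0)
       := ((v1 :+ a :* v0) :+ con 0 :* (v1 :+ a :* v0)) :+ x :* v0) refl (V 1) (V 0) x y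
  shift+-addDerivative y x V (suc n) =
    solve 6 (λ v2 v1 v0 x a z → (v2 :+ (x :+ (x :+ z)) :* v1) :+ a :* (v1 :+ (x :+ z) :* v0)
       := ((v2 :+ a :* v1) :+ (x :+ z) :* (v1 :+ a :* v0)) :+ x :* v1) refl
       (V (suc (suc n))) (V (suc n)) (V n) x y (n ⋆ x)

  -- Differentiation commutes with translation. The induction removes one factor `z + y` at a time,
  -- and the commutator supplies the `x` that raises the coefficient `n ⋆ x` to `suc n ⋆ x`.
  addDerivative-translate : ∀ y x V n →
    addDerivative x (translate y V) n ≈ translate y (addDerivative x V) n
  addDerivative-translate y x V zero    = refl
  addDerivative-translate y x V (suc n) = sym (begin
    translate y (shift+ y (addDerivative x V)) n
      ≈⟨ translate-cong y (shift+-addDerivative y x V) n ⟩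
    translate y (λ k → addDerivative x (shift+ y V) k + x * V k) n
      ≈⟨ translate-linear y x (addDerivative x (shift+ y V)) V n ⟩
    translate y (addDerivative x (shift+ y V)) n + x * translate y V n
      ≈⟨ +-congʳ (addDerivative-translate y x (shift+ y V) n) ⟨
    (translate y V (suc n) + (n ⋆ x) * translate y (shift+ y V) (pred n)) + x * translate y V n
      ≈⟨ +-congʳ (+-congˡ (pred-step n)) ⟩
    (translate y V (suc n) + (n ⋆ x) * translate y V n) + x * translate y V n
      ≈⟨ solve 4 (λ a b c d → (a :+ b :* d) :+ c :* d := a :+ (c :+ b) :* d) refl _ _ _ _ ⟩
    translate y V (suc n) + (x + n ⋆ x) * translate y V n ∎)
    where
    -- The truncation `pred 0 = 0` is harmless because its coefficient is `0 ⋆ x`.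
    pred-step : ∀ n → (n ⋆ x) * translate y (shift+ y V) (pred n) ≈ (n ⋆ x) * translate y V n
    pred-step zero    = trans (zeroˡ _) (sym (zeroˡ _))
    pred-step (suc n) = refl

  addDerivative-cong : ∀ x {V W : Seq} → (∀ n → V n ≈ W n) → ∀ n → addDerivative x V n ≈ addDerivative x W n
  addDerivative-cong x eq n = +-cong (eq n) (*-congˡ (eq (pred n)))

  addDerivatives-cong : ∀ r x {V W : Seq} → (∀ n → V n ≈ W n) → ∀ n → addDerivatives r x V n ≈
      addDerivatives r x W n
  addDerivatives-cong zero    x eq = eq
  addDerivatives-cong (suc r) x eq = addDerivative-cong (x zero) (addDerivatives-cong r (x ∘ suc) eq)

  addDerivatives-translate : ∀ y r x V n →
    addDerivatives r x (translate y V) n ≈ translate y (addDerivatives r x V) n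
  addDerivatives-translate y zero    x V n = refl
  addDerivatives-translate y (suc r) x V n =
    trans (addDerivative-cong (x zero) (addDerivatives-translate y r (x ∘ suc) V) n)
          (addDerivative-translate y (x zero) (addDerivatives r (x ∘ suc) V) n)

  δ₀ : Seq
  δ₀ zero    = 1#
  δ₀ (suc _) = 0#

  -- The backward value function of the Dyck path model after n blocks of r + 1 steps.
  blockValue : ∀ r → (Fin r → Carrier) → Carrier → ℕ → Seq
  blockValue r x y zero    = δ₀
  blockValue r x y (suc n) = addDerivatives r x (shift+ y (blockValue r x y n))

  translate-zero : ∀ y n → translate y (λ _ → 0#) n ≈ 0#
  translate-zero y zero    = refl
  translate-zero y (suc n) = trans (translate-cong y (λ _ → trans (+-identityˡ _) (zeroʳ y)) n)
      (translate-zero y n)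

  -- `δ₀` is evaluation at `z = 0`, so its translate is evaluation at `z = y`, which gives each root
  -- its weight `y`.
  translate-δ₀ : ∀ y n → translate y δ₀ n ≈ pow R y n
  translate-δ₀ y zero    = refl
  translate-δ₀ y (suc n) = begin
    translate y (shift+ y δ₀) n ≈⟨ translate-cong y (λ { zero → refl ; (suc _) → refl }) n ⟩
    translate y (λ k → 0# + y * δ₀ k) n ≈⟨ translate-linear y y (λ _ → 0#) δ₀ n ⟩
    translate y (λ _ → 0#) n + y * translate y δ₀ n ≈⟨ +-cong (translate-zero y n)
        (*-congˡ (translate-δ₀ y n)) ⟩
    0# + y * pow R y n ≈⟨ +-identityˡ _ ⟩
    y * pow R y n ∎

  -- Attaching leaves to one vertex

  -- m leaves decide in turn whether to become children of a vertex that already has d children;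
  -- a counts the trees left over for earlier vertices.
  attach : Seq → Seq → ℕ → ℕ → ℕ → Carrier
  attach ψ W zero    a d = ψ d * W a
  attach ψ W (suc m) a d = attach ψ W m a (suc d) + attach ψ W m (suc a) d

  attach-cong : ∀ {ψ ψ′ W W′ : Seq} → (∀ d → ψ d ≈ ψ′ d) → (∀ a → W a ≈ W′ a) →
    ∀ m a d → attach ψ W m a d ≈ attach ψ′ W′ m a d
  attach-cong p q zero    a d = *-cong (p d) (q a)
  attach-cong p q (suc m) a d = +-cong (attach-cong p q m a (suc d)) (attach-cong p q m (suc a) d)

  -- Unfolded, `attach ψ W m a d` is the sum over `i` of `C(m,i) ψ(d + i) W(a + m - i)`. The
  -- derivative brings down the factor `d + i`: its part `d` gives the last term, and its part `i`
  -- is absorbed by `i C(m,i) = m C(m - 1, i - 1)`.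
  attach-addDerivative : ∀ x ψ W m a d →
    attach (addDerivative x ψ) W m a d ≈
    attach ψ W m a d + (m ⋆ x) * attach ψ W (pred m) a d + (d ⋆ x) * attach ψ W m a (pred d)
  attach-addDerivative x ψ W zero a d = begin
    (ψ d + (d ⋆ x) * ψ (pred d)) * W a ≈⟨ distribʳ _ _ _ ⟩
    ψ d * W a + (d ⋆ x) * ψ (pred d) * W a ≈⟨ +-cong (sym (+-identityʳ _)) (*-assoc _ _ _) ⟩
    (ψ d * W a + 0#) + (d ⋆ x) * (ψ (pred d) * W a) ≈⟨ +-congʳ (+-congˡ (zeroˡ _)) ⟨
    (ψ d * W a + 0# * (ψ d * W a)) + (d ⋆ x) * (ψ (pred d) * W a) ∎
  attach-addDerivative x ψ W (suc m) a d = begin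
    attach (addDerivative x ψ) W m a (suc d) + attach (addDerivative x ψ) W m (suc a) d
      ≈⟨ +-cong (attach-addDerivative x ψ W m a (suc d)) (attach-addDerivative x ψ W m (suc a) d) ⟩
    (H m a (suc d) + (m ⋆ x) * H (pred m) a (suc d) + (x + d ⋆ x) * H m a d)
      + (H m (suc a) d + (m ⋆ x) * H (pred m) (suc a) d + (d ⋆ x) * H m (suc a) (pred d))
      ≈⟨ solve 9 (λ x mx dx h1 h2 h3 h4 h5 h6 →
           (h1 :+ mx :* h2 :+ (x :+ dx) :* h3) :+ (h4 :+ mx :* h5 :+ dx :* h6) :=
           ((h1 :+ h4) :+ (mx :* (h2 :+ h5) :+ x :* h3)) :+ (dx :* h3 :+ dx :* h6)) refl
           x (m ⋆ x) (d ⋆ x) (H m a (suc d)) (H (pred m) a (suc d)) (H m a d) (H m (suc a) d)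
           (H (pred m) (suc a) d) (H m (suc a) (pred d)) ⟩
    (H (suc m) a d + ((m ⋆ x) * (H (pred m) a (suc d) + H (pred m) (suc a) d) + x * H m a d))
      + ((d ⋆ x) * H m a d + (d ⋆ x) * H m (suc a) (pred d))
      ≈⟨ +-cong (+-congˡ (+-congʳ (m-step m))) (d-step d) ⟩
    (H (suc m) a d + ((m ⋆ x) * H m a d + x * H m a d)) + (d ⋆ x) * H (suc m) a (pred d)
      ≈⟨ +-congʳ (+-congˡ (trans (+-comm _ _) (sym (distribʳ _ _ _)))) ⟩
    (H (suc m) a d + (x + m ⋆ x) * H m a d) + (d ⋆ x) * H (suc m) a (pred d) ∎
    where
    H = attach ψ W
    m-step : ∀ m → (m ⋆ x) * (H (pred m) a (suc d) + H (pred m) (suc a) d) ≈ (m ⋆ x) * H m a d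
    m-step zero    = trans (zeroˡ _) (sym (zeroˡ _))
    m-step (suc m) = refl
    d-step : ∀ d → (d ⋆ x) * H m a d + (d ⋆ x) * H m (suc a) (pred d) ≈ (d ⋆ x) * H (suc m) a (pred d)
    d-step zero    = trans (+-cong (zeroˡ _) (zeroˡ _)) (trans (+-identityˡ _) (sym (zeroˡ _)))
    d-step (suc d) = sym (distribˡ _ _ _)

  attach-δ₀-suc : ∀ W m a d → attach δ₀ W m a (suc d) ≈ 0#
  attach-δ₀-suc W zero    a d = zeroˡ _
  attach-δ₀-suc W (suc m) a d =
    trans (+-cong (attach-δ₀-suc W m a (suc d)) (attach-δ₀-suc W m (suc a) d)) (+-identityˡ 0#)

  -- `δ₀` vanishes at positive degree, so only the choice in which all `m` leaves are passed on
  -- contributes.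
  attach-δ₀-zero : ∀ W m a → attach δ₀ W m a 0 ≈ W (m ℕ.+ a)
  attach-δ₀-zero W zero    a = *-identityˡ _
  attach-δ₀-zero W (suc m) a =
    trans (+-cong (attach-δ₀-suc W m a 0) (attach-δ₀-zero W m (suc a)))
          (trans (+-identityˡ _) (reflexive (≡.cong W (ℕₚ.+-suc m a))))

  -- The factors `1 + x_i d/dz` leave `attach` one by one, since at `d = 0` the last term of
  -- `attach-addDerivative` disappears. The initial `1` counts the new vertex itself as a root: this
  -- is the multiplication by `z`, dual to `W ∘ suc`.
  attach-addDerivatives : ∀ r x W m → attach (addDerivatives r x δ₀) W m 1 0 ≈ addDerivatives r x (W ∘ suc) m
  attach-addDerivatives zero    x W m =
    trans (attach-δ₀-zero W m 1) (reflexive (≡.cong W (ℕₚ.+-comm m 1)))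
  attach-addDerivatives (suc r) x W m = begin
    attach (addDerivative (x zero) (addDerivatives r (x ∘ suc) δ₀)) W m 1 0
      ≈⟨ attach-addDerivative (x zero) (addDerivatives r (x ∘ suc) δ₀) W m 1 0 ⟩
    H m + (m ⋆ x zero) * H (pred m) + 0# * H m
      ≈⟨ trans (+-congˡ (zeroˡ _)) (+-identityʳ _) ⟩
    H m + (m ⋆ x zero) * H (pred m)
      ≈⟨ addDerivative-cong (x zero) (attach-addDerivatives r (x ∘ suc) W) m ⟩
    addDerivatives (suc r) x (W ∘ suc) m ∎
    where
    H : Seq
    H k = attach (addDerivatives r (x ∘ suc) δ₀) W k 1 0

  -- The backward value function of the forest model: n inner vertices and m labelled leaves.
  leafValue : Seq → Carrier → ℕ → Seq
  leafValue ψ y zero    m = pow R y m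
  leafValue ψ y (suc n) m = attach ψ (leafValue ψ y n) m 1 0

  leafValue-translate : ∀ r x y n m →
    leafValue (addDerivatives r x δ₀) y n m ≈ translate y (blockValue r x y n) m
  leafValue-translate r x y zero    m = sym (translate-δ₀ y m)
  leafValue-translate r x y (suc n) m = begin
    attach ψ (leafValue ψ y n) m 1 0
      ≈⟨ attach-cong (λ _ → refl) (leafValue-translate r x y n) m 1 0 ⟩
    attach ψ (translate y V) m 1 0
      ≈⟨ attach-addDerivatives r x (translate y V) m ⟩
    -- By definition `translate y V ∘ suc` is `translate y (shift+ y V)`: under the substitution,
    -- multiplication by `z` has become multiplication by `z + y`.
    addDerivatives r x (translate y (shift+ y V)) m
      ≈⟨ addDerivatives-translate y r x (shift+ y V) m ⟩
    translate y (addDerivatives r x (shift+ y V)) m ∎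
    where
    ψ V : Seq
    ψ = addDerivatives r x δ₀
    V = blockValue r x y n

  -- Finite sums and products

  ΣL-cong : ∀ {a} {A : Set a} (xs : List A) {f g : A → Carrier} → (∀ x → f x ≈ g x) → ΣL R xs f ≈ ΣL R xs g
  ΣL-cong []       eq = refl
  ΣL-cong (x ∷ xs) eq = +-cong (eq x) (ΣL-cong xs eq)

  ΣL-++ : ∀ {a} {A : Set a} (xs ys : List A) f → ΣL R (xs ++ ys) f ≈ ΣL R xs f + ΣL R ys f
  ΣL-++ []       ys f = sym (+-identityˡ _)
  ΣL-++ (x ∷ xs) ys f = trans (+-congˡ (ΣL-++ xs ys f)) (sym (+-assoc _ _ _))

  ΣL-map : ∀ {a b} {A : Set a} {B : Set b} (g : A → B) xs f → ΣL R (map g xs) f ≈ ΣL R xs (f ∘ g)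
  ΣL-map g []       f = refl
  ΣL-map g (x ∷ xs) f = +-congˡ (ΣL-map g xs f)

  ΣL-concatMap : ∀ {a b} {A : Set a} {B : Set b} (g : A → List B) xs f →
    ΣL R (concatMap g xs) f ≈ ΣL R xs (λ x → ΣL R (g x) f)
  ΣL-concatMap g []       f = refl
  ΣL-concatMap g (x ∷ xs) f = trans (ΣL-++ (g x) _ f) (+-congˡ (ΣL-concatMap g xs f))

  ΣL-allVecs : ∀ {a} {A : Set a} (xs : List A) n (f : Vec A (suc n) → Carrier) →
    ΣL R (allVecs xs (suc n)) f ≈ ΣL R xs (λ x → ΣL R (allVecs xs n) (λ v → f (x ∷ v)))
  ΣL-allVecs xs n f =
    trans (ΣL-concatMap _ xs f) (ΣL-cong xs (λ x → ΣL-map (x ∷_) (allVecs xs n) f))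

  ΣL-*ˡ : ∀ {a} {A : Set a} c (xs : List A) f → ΣL R xs (λ x → c * f x) ≈ c * ΣL R xs f
  ΣL-*ˡ c []       f = sym (zeroʳ c)
  ΣL-*ˡ c (x ∷ xs) f = trans (+-congˡ (ΣL-*ˡ c xs f)) (sym (distribˡ _ _ _))

  ΣL-zero : ∀ {a} {A : Set a} (xs : List A) → ΣL R xs (λ _ → 0#) ≈ 0#
  ΣL-zero []       = refl
  ΣL-zero (x ∷ xs) = trans (+-identityˡ _) (ΣL-zero xs)

  if-cong : ∀ b {u u′ v v′ : Carrier} → u ≈ u′ → v ≈ v′ → (if b then u else v) ≈ (if b then u′ else v′)
  if-cong false p q = q
  if-cong true  p q = p

  if-* : ∀ b c u → (if b then c * u else 0#) ≈ c * (if b then u else 0#)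
  if-* false c u = sym (zeroʳ c)
  if-* true  c u = refl

  ΣL-∧ : ∀ {a} {A : Set a} (xs : List A) b (p : A → Bool) (f : A → Carrier) →
    ΣL R xs (λ x → if b ∧ p x then f x else 0#) ≈ (if b then ΣL R xs (λ x → if p x then f x else 0#) else 0#)
  ΣL-∧ xs false p f = ΣL-zero xs
  ΣL-∧ xs true  p f = refl

  ΣL-filter : ∀ {a} {A : Set a} (p : A → Bool) xs f →
    ΣL R (filter (λ x → T? (p x)) xs) f ≈ ΣL R xs (λ x → if p x then f x else 0#)
  ΣL-filter p []       f = refl
  ΣL-filter p (x ∷ xs) f with p x
  ... | true  = +-congˡ (ΣL-filter p xs f)
  ... | false = trans (ΣL-filter p xs f) (sym (+-identityˡ _))

  ΠL-tabulate : ∀ {a} {A : Set a} {n} (g : Fin n → A) f → ΠL R (tabulate g) f ≡ ΠL R (allFin n) (f ∘ g)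
  ΠL-tabulate {n = zero}  g f = ≡.refl
  ΠL-tabulate {n = suc n} g f = ≡.cong (f (g zero) *_)
    (≡.trans (ΠL-tabulate (g ∘ suc) f) (≡.sym (ΠL-tabulate suc (f ∘ g))))

  ΣL-tabulate : ∀ {a} {A : Set a} {n} (g : Fin n → A) f → ΣL R (tabulate g) f ≡ ΣL R (allFin n) (f ∘ g)
  ΣL-tabulate {n = zero}  g f = ≡.refl
  ΣL-tabulate {n = suc n} g f = ≡.cong (f (g zero) +_)
    (≡.trans (ΣL-tabulate (g ∘ suc) f) (≡.sym (ΣL-tabulate suc (f ∘ g))))

  -- Elementary symmetric polynomials

  subsetProduct : ∀ {r} → (Fin r → Carrier) → Vec Bool r → Carrier
  subsetProduct {r} x S = ΠL R (allFin r) (λ i → if Vec.lookup S i then x i else 1#)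

  size : ∀ {r} → Vec Bool r → ℕ
  size {r} S = count (Vec.lookup S) (allFin r)

  elem-if : ∀ r x k → elem R r x k ≈
    ΣL R (allVecs (true ∷ false ∷ []) r) (λ S → if size S ≡ᵇ k then subsetProduct x S else 0#)
  elem-if r x k = ΣL-filter (λ S → size S ≡ᵇ k) (allVecs (true ∷ false ∷ []) r) (subsetProduct x)

  subsetProduct-∷ : ∀ {r} (x : Fin (suc r) → Carrier) b S →
    subsetProduct x (b ∷ S) ≡ (if b then x zero else 1#) * subsetProduct (x ∘ suc) S
  subsetProduct-∷ x b S = ≡.cong ((if b then x zero else 1#) *_)
      (ΠL-tabulate Fin.suc (λ i → if Vec.lookup (b ∷ S) i then x i else 1#))

  -- The cases are whether the first variable is selected. The first sum keeps its test
  -- `suc (size S) ≡ᵇ k` so that one statement covers both `k = 0`, where it vanishes, and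
  -- `k = suc d`, where it is `x zero` times a smaller elementary symmetric polynomial.
  elem-suc : ∀ r x k → elem R (suc r) x k ≈
    ΣL R (allVecs (true ∷ false ∷ []) r) (λ S → if suc (size S) ≡ᵇ k then x zero * subsetProduct
        (x ∘ suc) S else 0#)
    + elem R r (x ∘ suc) k
  elem-suc r x k = begin
    elem R (suc r) x k ≈⟨ elem-if (suc r) x k ⟩
    ΣL R (allVecs bs (suc r)) (λ S → if size S ≡ᵇ k then subsetProduct x S else 0#)
      ≈⟨ ΣL-allVecs bs r _ ⟩
    ΣL R (allVecs bs r) (λ S → if size (true ∷ S) ≡ᵇ k then subsetProduct x (true ∷ S) else 0#)
      + (ΣL R (allVecs bs r) (λ S → if size (false ∷ S) ≡ᵇ k then subsetProduct x (false ∷ S) else 0#) + 0#)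
      ≈⟨ +-cong (ΣL-cong (allVecs bs r) (λ S → reflexive (≡.cong₂ (λ s w → if s ≡ᵇ k then w else 0#)
                    (≡.cong suc (count-tabulate suc (Vec.lookup (true ∷ S)))) (subsetProduct-∷ x true S))))
                (+-congʳ (ΣL-cong (allVecs bs r)
                    (λ S → trans (reflexive (≡.cong₂ (λ s w → if s ≡ᵇ k then w else 0#)
                    (count-tabulate suc (Vec.lookup (false ∷ S))) (subsetProduct-∷ x false S)))
                    (if-cong (size S ≡ᵇ k) (*-identityˡ _) refl)))) ⟩
    ΣL R (allVecs bs r) (λ S → if suc (size S) ≡ᵇ k then x zero * subsetProduct (x ∘ suc) S else 0#)
      + (ΣL R (allVecs bs r) (λ S → if size S ≡ᵇ k then subsetProduct (x ∘ suc) S else 0#) + 0#)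
      ≈⟨ +-congˡ (trans (+-identityʳ _) (sym (elem-if r (x ∘ suc) k))) ⟩
    _ ∎
    where
    bs : List Bool
    bs = true ∷ false ∷ []

  factorial : ℕ → Carrier
  factorial zero    = 1#
  factorial (suc n) = (suc n ⋆ 1#) * factorial n

  ⋆-* : ∀ n x → n ⋆ x ≈ (n ⋆ 1#) * x
  ⋆-* zero    x = sym (zeroˡ x)
  ⋆-* (suc n) x = trans (+-cong (sym (*-identityˡ x)) (⋆-* n x)) (sym (distribʳ _ _ _))

  -- Evaluates Π (1 + x_i d/dz) at z = 0: the coefficient of (d/dz)ᵈ is e_d(x).
  factorial-elem : ∀ r x d → factorial d * elem R r x d ≈ addDerivatives r x δ₀ d
  factorial-elem zero x zero    = solve 0 (con 1 :* (con 1 :+ con 0) := con 1) refl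
  factorial-elem zero x (suc d) = zeroʳ _
  factorial-elem (suc r) x zero = begin
    1# * elem R (suc r) x 0 ≈⟨ *-congˡ (elem-suc r x 0) ⟩
    1# * (ΣL R (allVecs (true ∷ false ∷ []) r) (λ S → 0#) + elem R r (x ∘ suc) 0)
      ≈⟨ *-congˡ (trans (+-congʳ (ΣL-zero (allVecs (true ∷ false ∷ []) r))) (+-identityˡ _)) ⟩
    1# * elem R r (x ∘ suc) 0 ≈⟨ factorial-elem r (x ∘ suc) 0 ⟩
    addDerivatives r (x ∘ suc) δ₀ 0 ≈⟨ trans (+-congˡ (zeroˡ _)) (+-identityʳ _) ⟨
    addDerivatives (suc r) x δ₀ 0 ∎
  factorial-elem (suc r) x (suc d) = begin
    (suc d ⋆ 1#) * factorial d * elem R (suc r) x (suc d) ≈⟨ *-congˡ (elem-suc r x (suc d)) ⟩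
    (suc d ⋆ 1#) * factorial d * (ΣL R Ss (λ S → if size S ≡ᵇ d then x zero * subsetProduct
        (x ∘ suc) S else 0#) + e (suc d))
      ≈⟨ *-congˡ (+-congʳ (trans (ΣL-cong Ss (λ S → if-* (size S ≡ᵇ d) _ _))
           (trans (ΣL-*ˡ (x zero) Ss _) (*-congˡ (sym (elem-if r (x ∘ suc) d)))))) ⟩
    (suc d ⋆ 1#) * factorial d * (x zero * e d + e (suc d))
      ≈⟨ solve 5 (λ D f x u v → D :* f :* (x :* u :+ v) := D :* f :* v :+ (D :* x) :* (f :* u)) refl
           (suc d ⋆ 1#) (factorial d) (x zero) (e d) (e (suc d)) ⟩
    (suc d ⋆ 1#) * factorial d * e (suc d) + ((suc d ⋆ 1#) * x zero) * (factorial d * e d)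
      ≈⟨ +-cong (factorial-elem r (x ∘ suc) (suc d))
           (*-cong (sym (⋆-* (suc d) (x zero))) (factorial-elem r (x ∘ suc) d)) ⟩
    addDerivatives (suc r) x δ₀ (suc d) ∎
    where
    Ss : List (Vec Bool r)
    Ss = allVecs (true ∷ false ∷ []) r
    e : Seq
    e = elem R r (x ∘ suc)

  -- Dyck paths

  pathSum : ℕ → Seq → ℕ → Seq
  pathSum m α n h = ΣL R (allVecs (true ∷ false ∷ []) n) λ v →
    if validFrom R m h (Vec.toList v) then weightFrom R m α h (Vec.toList v) else 0#

  pathSum-zero : ∀ m α h → pathSum m α 0 h ≈ (if h ≡ᵇ 0 then 1# else 0#)
  pathSum-zero m α h = +-identityʳ _

  pathSum-suc : ∀ m α n h → pathSum m α (suc n) h ≈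
    pathSum m α n (suc h) + (if m ≤ᵇ h then α h * pathSum m α n (h ∸ m) else 0#)
  pathSum-suc m α n h = begin
    pathSum m α (suc n) h ≈⟨ ΣL-allVecs (true ∷ false ∷ []) n _ ⟩
    pathSum m α n (suc h) + (_ + 0#) ≈⟨ +-congˡ (+-identityʳ _) ⟩
    pathSum m α n (suc h) + ΣL R (allVecs (true ∷ false ∷ []) n) (λ v →
        if (m ≤ᵇ h) ∧ validFrom R m (h ∸ m) (Vec.toList v) then α h * weightFrom R m α (h ∸ m)
            (Vec.toList v) else 0#)
      ≈⟨ +-congˡ (ΣL-∧ (allVecs (true ∷ false ∷ []) n) (m ≤ᵇ h) _ _) ⟩
    _ ≈⟨ +-congˡ (if-cong (m ≤ᵇ h)
           (trans (ΣL-cong (allVecs (true ∷ false ∷ []) n)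
               (λ v → if-* (validFrom R m (h ∸ m) (Vec.toList v)) (α h) _))
                  (ΣL-*ˡ (α h) (allVecs (true ∷ false ∷ []) n) _)) refl) ⟩
    pathSum m α n (suc h) + (if m ≤ᵇ h then α h * pathSum m α n (h ∸ m) else 0#) ∎

  -- Steps both raise the height by 1 modulo r + 1, so a block of r + 1 steps starting at a multiple
  -- of r + 1 meets the residues 0, …, r in order; j below is the number of steps of the block already made.
  pathSum-block : ∀ r α y s (x : Fin s → Carrier) n j → j ℕ.+ s ≡ r →
    (∀ i k → α (j ℕ.+ toℕ i ℕ.+ k ℕ.* suc r) ≈ k ⋆ x i) →
    (∀ k → α (r ℕ.+ k ℕ.* suc r) ≈ y) →
    ∀ k → pathSum r α (s ℕ.+ suc n) (j ℕ.+ k ℕ.* suc r) ≈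
          addDerivatives s x (shift+ y (λ k → pathSum r α n (k ℕ.* suc r))) k
  pathSum-block r α y zero x n j j+0≡r αx αy k with ≡.trans (≡.sym (ℕₚ.+-identityʳ j)) j+0≡r
  ... | ≡.refl = begin
    pathSum r α (suc n) h ≈⟨ pathSum-suc r α n h ⟩
    pathSum r α n (suc h) + (if r ≤ᵇ h then α h * pathSum r α n (h ∸ r) else 0#)
      -- At residue `r` a fall stays at height at least 0 for every `k`, including `k = 0`; this
      -- matches the factor `y` carrying no multiple of `k`.
      ≈⟨ +-congˡ (reflexive (≡.cong (λ b → if b then α h * pathSum r α n (h ∸ r) else 0#)
           (≤⇒≤ᵇ≡true (ℕₚ.m≤m+n r (k ℕ.* suc r))))) ⟩
    pathSum r α n (suc h) + α h * pathSum r α n (h ∸ r)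
      ≈⟨ +-congˡ (*-cong (αy k) (reflexive (≡.cong (pathSum r α n) (ℕₚ.m+n∸m≡n r (k ℕ.* suc r))))) ⟩
    pathSum r α n (suc h) + y * pathSum r α n (k ℕ.* suc r) ∎
    where
    h : ℕ
    h = r ℕ.+ k ℕ.* suc r
  pathSum-block r α y (suc s) x n j j+s≡r αx αy k = begin
    pathSum r α (suc (s ℕ.+ suc n)) h ≈⟨ pathSum-suc r α (s ℕ.+ suc n) h ⟩
    pathSum r α (s ℕ.+ suc n) (suc h) + (if r ≤ᵇ h then α h * pathSum r α (s ℕ.+ suc n) (h ∸ r) else 0#)
      ≈⟨ +-cong (IH k) (fall k) ⟩
    addDerivatives s (x ∘ suc) V k + (k ⋆ x zero) * addDerivatives s (x ∘ suc) V (pred k) ∎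
    where
    h : ℕ
    h = j ℕ.+ k ℕ.* suc r
    V : Seq
    V = shift+ y (λ k → pathSum r α n (k ℕ.* suc r))
    j+s≡r′ : suc (j ℕ.+ s) ≡ r
    j+s≡r′ = ≡.trans (≡.sym (ℕₚ.+-suc j s)) j+s≡r
    IH : ∀ k → pathSum r α (s ℕ.+ suc n) (suc j ℕ.+ k ℕ.* suc r) ≈ addDerivatives s (x ∘ suc) V k
    IH = pathSum-block r α y s (x ∘ suc) n (suc j) j+s≡r′
      (λ i k → trans (reflexive (≡.cong (λ a → α (a ℕ.+ k ℕ.* suc r)) (≡.sym (ℕₚ.+-suc j (toℕ i)))))
          (αx (suc i) k)) αy
    fall : ∀ k → (if r ≤ᵇ j ℕ.+ k ℕ.* suc r then α (j ℕ.+ k ℕ.* suc r) * pathSum r α (s ℕ.+ suc n)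
        (j ℕ.+ k ℕ.* suc r ∸ r) else 0#) ≈
       (k ⋆ x zero) * addDerivatives s (x ∘ suc) V (pred k)
    -- Height `j` is below `r`, so no fall is possible; on the operator side the derivative of a
    -- constant vanishes.
    fall zero rewrite >⇒≤ᵇ≡false {r} {j ℕ.+ 0} (≡.subst (j ℕ.+ 0 ℕ.<_) j+s≡r (ℕₚ.+-monoʳ-< j (ℕ.s≤s ℕ.z≤n))) =
      sym (zeroˡ _)
    fall (suc k) = begin
      (if r ≤ᵇ h′ then α h′ * pathSum r α (s ℕ.+ suc n) (h′ ∸ r) else 0#)
        ≈⟨ reflexive (≡.cong (λ b → if b then α h′ * pathSum r α (s ℕ.+ suc n) (h′ ∸ r) else 0#)
             (≤⇒≤ᵇ≡true (≡.subst (r ℕ.≤_) (≡.sym h′≡) (ℕₚ.m≤m+n r _)))) ⟩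
      α h′ * pathSum r α (s ℕ.+ suc n) (h′ ∸ r)
        ≈⟨ *-cong (trans (reflexive (≡.cong (λ a → α (a ℕ.+ suc k ℕ.* suc r)) (≡.sym (ℕₚ.+-identityʳ j))))
             (αx zero (suc k)))
                  (reflexive (≡.cong (pathSum r α (s ℕ.+ suc n))
                      (≡.trans (≡.cong (_∸ r) h′≡) (ℕₚ.m+n∸m≡n r _)))) ⟩
      (suc k ⋆ x zero) * pathSum r α (s ℕ.+ suc n) (suc j ℕ.+ k ℕ.* suc r)
        ≈⟨ *-congˡ (IH k) ⟩
      (suc k ⋆ x zero) * addDerivatives s (x ∘ suc) V k ∎
      where
      h′ : ℕ
      h′ = j ℕ.+ suc k ℕ.* suc r
      -- A fall by `r` raises the residue by one and lowers the multiple of `r + 1` by one.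
      h′≡ : h′ ≡ r ℕ.+ (suc j ℕ.+ k ℕ.* suc r)
      h′≡ = +-*-Solver.solve 3 (λ j r t → j +-*-Solver.:+ (+-*-Solver.con 1 +-*-Solver.:+ r +-*-Solver.:+ t)
        +-*-Solver.:= r +-*-Solver.:+ (+-*-Solver.con 1 +-*-Solver.:+ j +-*-Solver.:+ t)) ≡.refl j r
            (k ℕ.* suc r)

  pathSum-blockValue : ∀ r α (x : Fin r → Carrier) y →
    (∀ i k → α (toℕ i ℕ.+ k ℕ.* suc r) ≈ k ⋆ x i) →
    (∀ k → α (r ℕ.+ k ℕ.* suc r) ≈ y) →
    ∀ n k → pathSum r α (n ℕ.* suc r) (k ℕ.* suc r) ≈ blockValue r x y n k
  pathSum-blockValue r α x y αx αy zero zero    = pathSum-zero r α 0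
  pathSum-blockValue r α x y αx αy zero (suc k) = pathSum-zero r α (suc (r ℕ.+ k ℕ.* suc r))
  pathSum-blockValue r α x y αx αy (suc n) k = begin
    pathSum r α (suc (r ℕ.+ n ℕ.* suc r)) (k ℕ.* suc r)
      ≈⟨ reflexive (≡.cong (λ l → pathSum r α l (k ℕ.* suc r)) (≡.sym (ℕₚ.+-suc r (n ℕ.* suc r)))) ⟩
    pathSum r α (r ℕ.+ suc (n ℕ.* suc r)) (k ℕ.* suc r)
      ≈⟨ pathSum-block r α y r x (n ℕ.* suc r) 0 ≡.refl αx αy k ⟩
    addDerivatives r x (shift+ y (λ k → pathSum r α (n ℕ.* suc r) (k ℕ.* suc r))) k
      ≈⟨ addDerivatives-cong r x (λ k → +-cong (IH (suc k)) (*-congˡ (IH k))) k ⟩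
    blockValue r x y (suc n) k ∎
    where
    IH : ∀ k → pathSum r α (n ℕ.* suc r) (k ℕ.* suc r) ≈ blockValue r x y n k
    IH = pathSum-blockValue r α x y αx αy n

  alphaSeq-< : ∀ r (x : Fin r → Carrier) y i k → alphaSeq R r x y (toℕ i ℕ.+ k ℕ.* suc r) ≡ k ⋆ x i
  alphaSeq-< r x y i k with (toℕ i ℕ.+ k ℕ.* suc r) % suc r <? r
  ... | yes p = ≡.cong₂ _⋆_ quotient (≡.cong x
      (Finₚ.toℕ-injective (≡.trans (Finₚ.toℕ-fromℕ< p) (remainder-< (ℕₚ.m<n⇒m<1+n (Finₚ.toℕ<n i)) k))))
    where
    quotient : (toℕ i ℕ.+ k ℕ.* suc r) / suc r ≡ k
    quotient = ≡.trans (+-distrib-/-∣ʳ (toℕ i) (divides-refl k))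
      (≡.cong₂ ℕ._+_ (m<n⇒m/n≡0 (ℕₚ.m<n⇒m<1+n (Finₚ.toℕ<n i))) (m*n/n≡m k (suc r)))
  ... | no ¬p = ⊥-elim (¬p (≡.subst (ℕ._< r) (≡.sym (remainder-< (ℕₚ.m<n⇒m<1+n (Finₚ.toℕ<n i)) k))
      (Finₚ.toℕ<n i)))

  alphaSeq-≡ : ∀ r (x : Fin r → Carrier) y k → alphaSeq R r x y (r ℕ.+ k ℕ.* suc r) ≡ y
  alphaSeq-≡ r x y k with (r ℕ.+ k ℕ.* suc r) % suc r <? r
  ... | yes p = ⊥-elim (ℕₚ.<-irrefl (remainder-< (ℕₚ.n<1+n r) k) p)
  ... | no _  = ≡.refl

  stieltjesRogers-blockValue : ∀ r (x : Fin r → Carrier) y n →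
    stieltjesRogers R r (alphaSeq R r x y) n ≈ blockValue r x y n 0
  stieltjesRogers-blockValue r x y n = trans
    (reflexive (≡.cong (λ l → pathSum r (alphaSeq R r x y) l 0) (ℕₚ.*-comm (suc r) n)))
    (pathSum-blockValue r (alphaSeq R r x y) x y (λ i k → reflexive (alphaSeq-< r x y i k))
      (λ k → reflexive (alphaSeq-≡ r x y k)) n 0)

  -- Choosing the parents

  Σ< Π< : ℕ → Seq → Carrier
  Σ< zero    f = 0#
  Σ< (suc n) f = f n + Σ< n f
  Π< zero    f = 1#
  Π< (suc n) f = f n * Π< n f

  Σ<-cong : ∀ n {f g} → (∀ u → u ℕ.< n → f u ≈ g u) → Σ< n f ≈ Σ< n g
  Σ<-cong zero    eq = refl
  Σ<-cong (suc n) eq = +-cong (eq n ℕₚ.≤-refl) (Σ<-cong n (λ u u<n → eq u (ℕₚ.m<n⇒m<1+n u<n)))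

  Π<-cong : ∀ n {f g} → (∀ u → u ℕ.< n → f u ≈ g u) → Π< n f ≈ Π< n g
  Π<-cong zero    eq = refl
  Π<-cong (suc n) eq = *-cong (eq n ℕₚ.≤-refl) (Π<-cong n (λ u u<n → eq u (ℕₚ.m<n⇒m<1+n u<n)))

  Σ<-+ : ∀ n f g → Σ< n (λ u → f u + g u) ≈ Σ< n f + Σ< n g
  Σ<-+ zero    f g = sym (+-identityˡ _)
  Σ<-+ (suc n) f g = trans (+-congˡ (Σ<-+ n f g)) (+-interchange _ _ _ _)

  Σ<-*ˡ : ∀ n c f → Σ< n (λ u → c * f u) ≈ c * Σ< n f
  Σ<-*ˡ zero    c f = sym (zeroʳ c)
  Σ<-*ˡ (suc n) c f = trans (+-congˡ (Σ<-*ˡ n c f)) (sym (distribˡ _ _ _))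

  Σ<-front : ∀ n f → Σ< (suc n) f ≈ f 0 + Σ< n (f ∘ suc)
  Σ<-front zero    f = refl
  Σ<-front (suc n) f = trans (+-congˡ (Σ<-front n f))
      (solve 3 (λ a b c → a :+ (b :+ c) := b :+ (a :+ c)) refl _ _ _)

  Π<-front : ∀ n f → Π< (suc n) f ≈ f 0 * Π< n (f ∘ suc)
  Π<-front zero    f = refl
  Π<-front (suc n) f = trans (*-congˡ (Π<-front n f)) (*-swap _ _ _)

  ΣL-allFin : ∀ n f → ΣL R (allFin n) (f ∘ toℕ) ≈ Σ< n f
  ΣL-allFin zero    f = refl
  ΣL-allFin (suc n) f = trans (+-congˡ (trans (reflexive (ΣL-tabulate {n = n} Fin.suc (f ∘ toℕ)))
      (ΣL-allFin n (f ∘ suc)))) (sym (Σ<-front n f))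

  ΠL-allFin : ∀ n f → ΠL R (allFin n) (f ∘ toℕ) ≈ Π< n f
  ΠL-allFin zero    f = refl
  ΠL-allFin (suc n) f = trans (*-congˡ (trans (reflexive (ΠL-tabulate {n = n} Fin.suc (f ∘ toℕ)))
      (ΠL-allFin n (f ∘ suc)))) (sym (Π<-front n f))

  Σ<-restrict : ∀ {t n} → t ℕ.≤ n → ∀ f → Σ< n (λ u → if u <ᵇ t then f u else 0#) ≈ Σ< t f
  Σ<-restrict {zero}  {zero}  t≤n f = refl
  Σ<-restrict {t}     {suc n} t≤n f with t ℕ.≟ suc n
  ... | yes ≡.refl = Σ<-cong (suc n) (λ u u<t → reflexive
      (≡.cong (λ b → if b then f u else 0#) (<⇒<ᵇ≡true u<t)))
  ... | no t≢1+n = trans (+-cong (reflexive (≡.cong (λ b → if b then f n else 0#) (≥⇒<ᵇ≡false t≤n′)))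
      (Σ<-restrict t≤n′ f)) (+-identityˡ _)
    where
    t≤n′ : t ℕ.≤ n
    t≤n′ = ℕ.s≤s⁻¹ (ℕₚ.≤∧≢⇒< t≤n t≢1+n)

  -- Vertices bounded by bs choose parents one after another; d records the degrees reached so far.
  parentSum : Seq → Carrier → ℕ → List ℕ → (ℕ → ℕ) → Carrier
  parentSum ψ y n []       d = Π< n (ψ ∘ d)
  parentSum ψ y n (b ∷ bs) d = y * parentSum ψ y n bs d + Σ< b (λ u → parentSum ψ y n bs (bump u d))

  module _ (ψ : Seq) (y : Carrier) where

    parentSum-cong : ∀ n bs {d e} → (∀ u → u ℕ.< n → d u ≡ e u) → parentSum ψ y n bs d ≈ parentSum ψ y n bs e
    parentSum-cong n []       eq = Π<-cong n (λ u u<n → reflexive (≡.cong ψ (eq u u<n)))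
    parentSum-cong n (b ∷ bs) {d} {e} eq = +-cong (*-congˡ (parentSum-cong n bs eq))
      (Σ<-cong b (λ u _ → parentSum-cong n bs (λ w w<n → bump-cong u {d} {e} w (eq w w<n))))

    -- The bound `suc N` allows exactly one more parent than `N`. Since only the final degrees
    -- matter, choosing `N` can be moved ahead of the choices made in `bs`, by `bump-comm`.
    parentSum-split : ∀ n N bs bs′ d → parentSum ψ y n (bs ++ suc N ∷ bs′) d ≈
      parentSum ψ y n (bs ++ bs′) (bump N d) + parentSum ψ y n (bs ++ N ∷ bs′) d
    parentSum-split n N [] bs′ d = solve 3 (λ a b c → a :+ (b :+ c) := b :+ (a :+ c)) refl _ _ _
    parentSum-split n N (b ∷ bs) bs′ d = begin
      y * parentSum ψ y n (bs ++ suc N ∷ bs′) d + Σ< b (λ u → parentSum ψ y n (bs ++ suc N ∷ bs′) (bump u d))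
        ≈⟨ +-cong (*-congˡ (parentSum-split n N bs bs′ d))
             (trans (Σ<-cong b (λ u _ → trans (parentSum-split n N bs bs′ (bump u d))
                        (+-congʳ (parentSum-cong n (bs ++ bs′) (λ w _ → bump-comm N u d w)))))
                    (Σ<-+ b _ _)) ⟩
      y * (P (bump N d) + Q d) + (Σ< b (λ u → P (bump u (bump N d))) + Σ< b (λ u → Q (bump u d)))
        ≈⟨ solve 5 (λ y p q s t → y :* (p :+ q) :+ (s :+ t) := (y :* p :+ s) :+ (y :* q :+ t)) refl _ _ _ _ _ ⟩
      (y * P (bump N d) + Σ< b (λ u → P (bump u (bump N d)))) + (y * Q d + Σ< b (λ u → Q (bump u d))) ∎
      where
      P Q : (ℕ → ℕ) → Carrier
      P = parentSum ψ y n (bs ++ bs′)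
      Q = parentSum ψ y n (bs ++ N ∷ bs′)

    -- No remaining vertex can choose `n`, so its degree is final and its weight factors out.
    parentSum-last : ∀ n bs d → All (ℕ._≤ n) bs → parentSum ψ y (suc n) bs d ≈ ψ (d n) * parentSum ψ y n bs d
    parentSum-last n []       d []         = refl
    parentSum-last n (b ∷ bs) d (b≤n ∷ ps) = begin
      y * parentSum ψ y (suc n) bs d + Σ< b (λ u → parentSum ψ y (suc n) bs (bump u d))
        ≈⟨ +-cong (*-congˡ (parentSum-last n bs d ps))
             (trans (Σ<-cong b (λ u u<b → trans (parentSum-last n bs (bump u d) ps)
                        (*-congʳ (reflexive (≡.cong ψ (bump-other d (ℕₚ.>⇒≢ (ℕₚ.<-≤-trans u<b b≤n))))))))
                    (Σ<-*ˡ b (ψ (d n)) _)) ⟩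
      y * (ψ (d n) * P d) + ψ (d n) * Σ< b (λ u → P (bump u d))
        ≈⟨ solve 4 (λ y a p s → y :* (a :* p) :+ a :* s := a :* (y :* p :+ s)) refl _ _ _ _ ⟩
      ψ (d n) * (y * P d + Σ< b (λ u → P (bump u d))) ∎
      where
      P : (ℕ → ℕ) → Carrier
      P = parentSum ψ y n bs

    -- Here parents choosing becomes children being chosen. Each leaf bounded by `suc n` either goes
    -- to vertex `n` or drops to the bound `n`; in the latter case it joins the end of
    -- `parentBounds n a`, which becomes `parentBounds n (suc a)`.
    parentSum-attach : ∀ n m a d →
      parentSum ψ y (suc n) (parentBounds n a ++ replicate m (suc n)) d ≈
      attach ψ (λ a → parentSum ψ y n (parentBounds n a) d) m a (d n)
    parentSum-attach n zero a d =
      trans (reflexive (≡.cong (λ bs → parentSum ψ y (suc n) bs d) (++-identityʳ (parentBounds n a))))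
            (parentSum-last n (parentBounds n a) d (parentBounds-≤ n a))
    parentSum-attach n (suc m) a d = begin
      parentSum ψ y (suc n) (parentBounds n a ++ suc n ∷ replicate m (suc n)) d
        ≈⟨ parentSum-split (suc n) n (parentBounds n a) (replicate m (suc n)) d ⟩
      parentSum ψ y (suc n) (parentBounds n a ++ replicate m (suc n)) (bump n d)
        + parentSum ψ y (suc n) (parentBounds n a ++ n ∷ replicate m (suc n)) d
        ≈⟨ +-cong (trans (parentSum-attach n m a (bump n d))
                     (trans (attach-cong (λ _ → refl) (λ a → parentSum-cong n (parentBounds n a)
                               (λ w w<n → bump-other d (ℕₚ.<⇒≢ w<n))) m a (bump n d n))
                            (reflexive (≡.cong (attach ψ _ m a) (bump-self n d)))))
                  (trans (reflexive (≡.cong (λ bs → parentSum ψ y (suc n) bs d)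
                           (≡.trans (≡.sym (∷ʳ-++ (parentBounds n a) n _))
                                    (≡.cong (_++ replicate m (suc n)) (≡.sym (parentBounds-suc n a))))))
                         (parentSum-attach n m (suc a) d)) ⟩
      attach ψ _ m a (suc (d n)) + attach ψ _ m (suc a) (d n) ∎

    parentSum-leafValue : ∀ n m → parentSum ψ y n (parentBounds n m) (λ _ → 0) ≈ leafValue ψ y n m
    parentSum-leafValue zero m =
      trans (reflexive (≡.cong (λ bs → parentSum ψ y 0 bs (λ _ → 0)) (parentBounds-zero m))) (all-roots m)
      where
      all-roots : ∀ m → parentSum ψ y 0 (replicate m 0) (λ _ → 0) ≈ pow R y m
      all-roots zero    = refl
      all-roots (suc m) = trans (+-identityʳ _) (*-congˡ (all-roots m))
    parentSum-leafValue (suc n) m = begin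
      parentSum ψ y (suc n) (parentBounds (suc n) m) (λ _ → 0)
        ≈⟨ reflexive (≡.cong (λ bs → parentSum ψ y (suc n) bs (λ _ → 0)) (parentBounds-leaves n m)) ⟩
      parentSum ψ y (suc n) (parentBounds n 1 ++ replicate m (suc n)) (λ _ → 0)
        ≈⟨ parentSum-attach n m 1 (λ _ → 0) ⟩
      attach ψ (λ a → parentSum ψ y n (parentBounds n a) (λ _ → 0)) m 1 0
        ≈⟨ attach-cong (λ _ → refl) (parentSum-leafValue n) m 1 0 ⟩
      leafValue ψ y (suc n) m ∎

    -- The accumulator `d` holds the children contributed by entries already read, which lets the
    -- induction strip the first entry of `p`. The bound `t + m ≤ n` ensures that every parent below
    -- `t` occurs in `Fin n`.
    parentSum-Parents : ∀ n m t d → t ℕ.+ m ℕ.≤ n →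
      ΣL R (allVecs (nothing ∷ map just (allFin n)) m) (λ p →
        if increasingFrom t p then pow R y (roots p) * Π< n (λ u → ψ (degree p u ℕ.+ d u)) else 0#)
      ≈ parentSum ψ y n (range t m) d
    parentSum-Parents n zero t d t+m≤n = trans (+-identityʳ _) (*-identityˡ _)
    parentSum-Parents n (suc m) t d t+m≤n = begin
      ΣL R (allVecs (nothing ∷ map just (allFin n)) (suc m)) (F t d)
        ≈⟨ ΣL-allVecs (nothing ∷ map just (allFin n)) m (F t d) ⟩
      ΣL R Ps (λ p → F t d (nothing ∷ p)) + ΣL R (map just (allFin n)) (λ x → ΣL R Ps (λ p → F t d (x ∷ p)))
        ≈⟨ +-cong root (trans (ΣL-map just (allFin n) _) (trans (ΣL-cong (allFin n) child)
             (trans (ΣL-allFin n _) (Σ<-restrict (ℕₚ.m+n≤o⇒m≤o t t+m≤n) _)))) ⟩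
      y * parentSum ψ y n (range (suc t) m) d + Σ< t (λ u → parentSum ψ y n (range (suc t) m) (bump u d)) ∎
      where
      Ps : List (Parents n m)
      Ps = allVecs (nothing ∷ map just (allFin n)) m
      F : ∀ {m} → ℕ → (ℕ → ℕ) → Parents n m → Carrier
      F t d p = if increasingFrom t p then pow R y (roots p) * Π< n (λ u → ψ (degree p u ℕ.+ d u)) else 0#
      t+m≤n′ : suc t ℕ.+ m ℕ.≤ n
      t+m≤n′ = ≡.subst (ℕ._≤ n) (ℕₚ.+-suc t m) t+m≤n
      root : ΣL R Ps (λ p → F t d (nothing ∷ p)) ≈ y * parentSum ψ y n (range (suc t) m) d
      root = begin
        ΣL R Ps (λ p → F t d (nothing ∷ p))
          ≈⟨ ΣL-cong Ps (λ p → trans (if-cong (increasingFrom (suc t) p) (*-assoc _ _ _) refl)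
                                     (if-* (increasingFrom (suc t) p) y _)) ⟩
        ΣL R Ps (λ p → y * F (suc t) d p) ≈⟨ ΣL-*ˡ y Ps (F (suc t) d) ⟩
        y * ΣL R Ps (F (suc t) d) ≈⟨ *-congˡ (parentSum-Parents n m (suc t) d t+m≤n′) ⟩
        y * parentSum ψ y n (range (suc t) m) d ∎
      bump-+ : ∀ u (p : Parents n m) w → bump u (degree p) w ℕ.+ d w ≡ degree p w ℕ.+ bump u d w
      bump-+ u p w with w ≡ᵇ u
      ... | true  = ≡.sym (ℕₚ.+-suc (degree p w) (d w))
      ... | false = ≡.refl
      child : ∀ (u : Fin n) → ΣL R Ps (λ p → F t d (just u ∷ p)) ≈
        (if toℕ u <ᵇ t then parentSum ψ y n (range (suc t) m) (bump (toℕ u) d) else 0#)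
      child u = begin
        ΣL R Ps (λ p → F t d (just u ∷ p))
          ≈⟨ ΣL-∧ Ps (toℕ u <ᵇ t) (increasingFrom (suc t)) _ ⟩
        (if toℕ u <ᵇ t then ΣL R Ps (λ p → if increasingFrom (suc t) p then
            pow R y (roots p) * Π< n (λ w → ψ (bump (toℕ u) (degree p) w ℕ.+ d w)) else 0#) else 0#)
          ≈⟨ if-cong (toℕ u <ᵇ t) (trans (ΣL-cong Ps (λ p → if-cong (increasingFrom (suc t) p)
                 (*-congˡ (Π<-cong n (λ w _ → reflexive (≡.cong ψ (bump-+ (toℕ u) p w))))) refl))
               (parentSum-Parents n m (suc t) (bump (toℕ u) d) t+m≤n′)) refl ⟩
        (if toℕ u <ᵇ t then parentSum ψ y n (range (suc t) m) (bump (toℕ u) d) else 0#) ∎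

  -- From the forest encoding to parent choices

  increasing-increasingFrom : ∀ n p q → increasing R n p q ≡ increasingFrom 0 p
  increasing-increasingFrom n p q = T-ext
    (λ t → increasingFrom⁺ 0 p (λ v u pv → ℕₚ.<ᵇ⇒< _ _ (T-⇒⁻ (all-allFin⁻ (all-allFin⁻ t v) u) (isJust≡⁺ pv))))
    (λ t → all-allFin⁺ (λ v → all-allFin⁺ (λ u → T-⇒⁺
        (λ pv → ℕₚ.<⇒<ᵇ (increasingFrom⁻ 0 p t v u (isJust≡⁻ pv))))))

  -- The pool `initial p` encodes `ranksBounded`, its shrinking encodes `ranksInjective`, and
  -- counting it yields `ranksSurjective`.
  ranks-ranked : ∀ n p q →
    (rootsRank0 R n p q ∧ ranksBounded R n p q ∧ ranksInjective R n p q ∧ ranksSurjective R n p q) ≡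
    ranked (initial p) p q
  ranks-ranked n p q = T-ext to from
    where
    deg≡ : ∀ u → deg R n p q u ≡ degree p (toℕ u)
    deg≡ = count-degree p
    to : T (rootsRank0 R n p q ∧ ranksBounded R n p q ∧ ranksInjective R n p q ∧ ranksSurjective R n p q) → T
        (ranked (initial p) p q)
    to t with T-∧⁻ {rootsRank0 R n p q} t
    ... | t₁ , t₂ with T-∧⁻ {ranksBounded R n p q} t₂
    ...   | t₂₁ , t₃ = ranked⁺ (initial p) p q record
      { rootRank = λ v pv → ℕₚ.≡ᵇ⇒≡ _ _ (T-⇒⁻ (all-allFin⁻ t₁ v) (isNothing⁺ pv))
      ; rankFree = λ v {u} pv → ≡.subst (λ d → T (toℕ (lookup q v) <ᵇ d)) (deg≡ u)
          (T-⇒⁻ (all-allFin⁻ (all-allFin⁻ t₂₁ v) u) (isJust≡⁺ pv))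
      ; rankInj = λ v w {u} a b c → finEq⁻ (T-⇒⁻
           (all-allFin⁻ (all-allFin⁻ (all-allFin⁻ (proj₁ (T-∧⁻ {ranksInjective R n p q} t₃)) u) v) w)
          (T-∧⁺ (isJust≡⁺ a) (T-∧⁺ (isJust≡⁺ b) (finEq⁺ c)))) }
    from : T (ranked (initial p) p q) → T (rootsRank0 R n p q ∧ ranksBounded R n p q ∧ ranksInjective R n p q ∧ ranksSurjective R n p q)
    from t = T-∧⁺ (all-allFin⁺ (λ v → T-⇒⁺ (λ pv → ℕₚ.≡⇒≡ᵇ _ _ (rootRank r v (isNothing⁻ pv)))))
      (T-∧⁺ (all-allFin⁺ (λ v → all-allFin⁺ (λ u → T-⇒⁺ (λ pv →
        ≡.subst (λ d → T (toℕ (lookup q v) <ᵇ d)) (≡.sym (deg≡ u)) (rankFree r v (isJust≡⁻ pv))))))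
      (T-∧⁺ (all-allFin⁺ (λ u → all-allFin⁺ (λ v → all-allFin⁺
          (λ w → T-⇒⁺ (λ abc → finEq⁺ (injective u v w abc))))))
            (all-allFin⁺ (λ u → all-allFin⁺ (λ j → T-⇒⁺
                (λ j<d → surjective u j (≡.subst (λ d → T (toℕ j <ᵇ d)) (deg≡ u) j<d)))))))
      where
      r : Ranked (initial p) p q
      r = ranked⁻ (initial p) p q t
      injective : ∀ u v w → T (isJust≡ (lookup p v) u ∧ isJust≡ (lookup p w) u ∧ finEq (lookup q v)
          (lookup q w)) → v ≡ w
      injective u v w abc with T-∧⁻ {isJust≡ (lookup p v) u} abc
      ... | a , bc with T-∧⁻ {isJust≡ (lookup p w) u} bc
      ...   | b , c = rankInj r v w (isJust≡⁻ a) (isJust≡⁻ b) (finEq⁻ c)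
      surjective : ∀ (u j : Fin n) → T (toℕ j <ᵇ degree p (toℕ u)) →
        T (any (λ v → isJust≡ (lookup p v) u ∧ finEq (lookup q v) j) (allFin n))
      surjective u j j<d with ranked-surjective (initial p) p q (initial-degree p) t u j j<d
      ... | v , pv , qv = any-allFin⁺ v (T-∧⁺ (isJust≡⁺ pv) (finEq⁺ qv))

  isForest-ranked : ∀ n p q → isForest R n p q ≡ (increasingFrom 0 p ∧ ranked (initial p) p q)
  isForest-ranked n p q = ≡.cong₂ _∧_ (increasing-increasingFrom n p q) (ranks-ranked n p q)

  forestWeight-degree : ∀ n p q φ y → forestWeight R n p q φ y ≈ pow R y (roots p) * Π< n (φ ∘ degree p)
  forestWeight-degree n p q φ y = *-cong (reflexive (≡.cong (pow R y) (count-roots p)))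
    (trans (ΠL-cong (allFin n) (λ v → reflexive (≡.cong φ (count-degree p v)))) (ΠL-allFin n (φ ∘ degree p)))
    where
    ΠL-cong : ∀ {a} {A : Set a} (xs : List A) {f g : A → Carrier} → (∀ x → f x ≈ g x) → ΠL R xs f ≈ ΠL R xs g
    ΠL-cong []       eq = refl
    ΠL-cong (x ∷ xs) eq = *-cong (eq x) (ΠL-cong xs eq)

  -- Counting the orders of the children

  Π<-update : ∀ n {f g c u} → u ℕ.< n → f u ≈ c * g u → (∀ w → w ≢ u → f w ≈ g w) → Π< n f ≈ c * Π< n g
  Π<-update (suc n) {f} {g} {c} {u} u<1+n fu eq with n ℕ.≟ u
  ... | yes ≡.refl = trans (*-cong fu (Π<-cong n (λ w w<n → eq w (ℕₚ.<⇒≢ w<n)))) (*-assoc _ _ _)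
  ... | no n≢u = trans (*-cong (eq n n≢u) (Π<-update n (ℕₚ.≤∧≢⇒< (ℕ.s≤s⁻¹ u<1+n) (n≢u ∘ ≡.sym)) fu eq))
      (*-swap _ _ _)

  Π<-* : ∀ n f g → Π< n f * Π< n g ≈ Π< n (λ u → f u * g u)
  Π<-* zero    f g = *-identityˡ _
  Π<-* (suc n) f g = trans (solve 4 (λ a b c d → (a :* b) :* (c :* d) := (a :* c) :* (b :* d)) refl _ _ _ _)
      (*-congˡ (Π<-* n f g))

  Σ<-#< : ∀ n f v → Σ< n (λ j → if f j then v else 0#) ≈ (#< n f ⋆ 1#) * v
  Σ<-#< zero    f v = sym (zeroˡ v)
  Σ<-#< (suc n) f v with f n
  ... | true  = trans (+-cong (sym (*-identityˡ v)) (Σ<-#< n f v)) (sym (distribʳ _ _ _))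
  ... | false = trans (+-identityˡ _) (Σ<-#< n f v)

  Σ<-zero : ∀ n → Σ< n (λ _ → 0#) ≈ 0#
  Σ<-zero zero    = refl
  Σ<-zero (suc n) = trans (+-identityˡ _) (Σ<-zero n)

  Σ<-first : ∀ n v → 0 ℕ.< n → Σ< n (λ j → if j ≡ᵇ 0 then v else 0#) ≈ v
  Σ<-first (suc n) v _ = trans (Σ<-front n _) (trans (+-congˡ (Σ<-zero n)) (+-identityʳ v))

  -- A child can take as many ranks as its parent has children left to read, itself included, so the
  -- choices at one parent multiply to the factorial of its degree.
  Σ-ranked : ∀ n m (p : Parents n m) free w → m ℕ.≤ n → (∀ u → #< n (free u) ≡ degree p u) →
    ΣL R (allVecs (allFin n) m) (λ q → if ranked free p q then w else 0#) ≈ Π< n (factorial ∘ degree p) * w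
  Σ-ranked n zero [] free w m≤n eq = trans (+-identityʳ w)
      (trans (sym (*-identityˡ w)) (*-congʳ (sym (Π<-one n))))
    where
    Π<-one : ∀ n → Π< n (λ _ → 1#) ≈ 1#
    Π<-one zero    = refl
    Π<-one (suc n) = trans (*-identityˡ _) (Π<-one n)
  Σ-ranked n (suc m) (nothing ∷ p) free w m<n eq = begin
    ΣL R (allVecs (allFin n) (suc m)) (λ q → if ranked free (nothing ∷ p) q then w else 0#)
      ≈⟨ ΣL-allVecs (allFin n) m _ ⟩
    ΣL R (allFin n) (λ j → ΣL R (allVecs (allFin n) m) (λ q → if (toℕ j ≡ᵇ 0) ∧ ranked free p q then w else 0#))
      ≈⟨ ΣL-cong (allFin n) (λ j → trans (ΣL-∧ (allVecs (allFin n) m) (toℕ j ≡ᵇ 0) _ _)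
            (if-cong (toℕ j ≡ᵇ 0) (Σ-ranked n m p free w (ℕₚ.<⇒≤ m<n) eq) refl)) ⟩
    ΣL R (allFin n) (λ j → if toℕ j ≡ᵇ 0 then Π< n (factorial ∘ degree p) * w else 0#)
      ≈⟨ ΣL-allFin n (λ j → if j ≡ᵇ 0 then Π< n (factorial ∘ degree p) * w else 0#) ⟩
    Σ< n (λ j → if j ≡ᵇ 0 then Π< n (factorial ∘ degree p) * w else 0#)
      -- The forced rank 0 of a root must exist in `Fin n`; the bound on the length of `p`
      -- guarantees that `n` is positive.
      ≈⟨ Σ<-first n _ (ℕₚ.≤-<-trans ℕ.z≤n m<n) ⟩
    Π< n (factorial ∘ degree p) * w ∎
  Σ-ranked n (suc m) (just u ∷ p) free w m<n eq = begin
    ΣL R (allVecs (allFin n) (suc m)) (λ q → if ranked free (just u ∷ p) q then w else 0#)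
      ≈⟨ ΣL-allVecs (allFin n) m _ ⟩
    ΣL R (allFin n) (λ j → ΣL R (allVecs (allFin n) m) (λ q →
        if free (toℕ u) (toℕ j) ∧ ranked (remove (toℕ u) (toℕ j) free) p q then w else 0#))
      ≈⟨ ΣL-cong (allFin n) (λ j → trans (ΣL-∧ (allVecs (allFin n) m) (free (toℕ u) (toℕ j)) _ _) (IH j)) ⟩
    ΣL R (allFin n) (λ j → if free (toℕ u) (toℕ j) then Π< n (factorial ∘ degree p) * w else 0#)
      ≈⟨ ΣL-allFin n (λ j → if free (toℕ u) j then Π< n (factorial ∘ degree p) * w else 0#) ⟩
    Σ< n (λ j → if free (toℕ u) j then Π< n (factorial ∘ degree p) * w else 0#)
      ≈⟨ Σ<-#< n (free (toℕ u)) _ ⟩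
    (#< n (free (toℕ u)) ⋆ 1#) * (Π< n (factorial ∘ degree p) * w)
      ≈⟨ *-congʳ (reflexive (≡.cong (_⋆ 1#) (≡.trans (eq (toℕ u)) (bump-self (toℕ u) (degree p))))) ⟩
    (suc (degree p (toℕ u)) ⋆ 1#) * (Π< n (factorial ∘ degree p) * w) ≈⟨ *-assoc _ _ _ ⟨
    (suc (degree p (toℕ u)) ⋆ 1#) * Π< n (factorial ∘ degree p) * w
      ≈⟨ *-congʳ (Π<-update n (Finₚ.toℕ<n u)
           (reflexive (≡.cong factorial (bump-self (toℕ u) (degree p))))
           (λ w w≢u → reflexive (≡.cong factorial (bump-other (degree p) w≢u)))) ⟨
    Π< n (factorial ∘ bump (toℕ u) (degree p)) * w ∎
    where
    IH : ∀ j → (if free (toℕ u) (toℕ j) then ΣL R (allVecs (allFin n) m) (λ q →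
                  if ranked (remove (toℕ u) (toℕ j) free) p q then w else 0#) else 0#) ≈
               (if free (toℕ u) (toℕ j) then Π< n (factorial ∘ degree p) * w else 0#)
    -- Removing a rank preserves the counting invariant only if the rank was free, so this fact is
    -- recorded as `fuj`.
    IH j with free (toℕ u) (toℕ j) in fuj
    ... | false = refl
    ... | true  = Σ-ranked n m p _ w (ℕₚ.<⇒≤ m<n)
      (remove-degree n p free (toℕ u) (toℕ j) (Finₚ.toℕ<n j) (Equivalence.from T-≡ fuj) eq)

  -- Summing over the ranks with the parents fixed replaces each weight `φ d` by
  -- `factorial d * φ d`; what remains is a sum over parent choices.
  lah-leafValue : ∀ φ y n → lah R φ y n ≈ leafValue (λ d → factorial d * φ d) y n 0
  lah-leafValue φ y n = begin
    lah R φ y n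
      ≈⟨ ΣL-concatMap (λ p → map (p ,_) Qs) Ps _ ⟩
    ΣL R Ps (λ p → ΣL R (map (p ,_) Qs) _)
      ≈⟨ ΣL-cong Ps (λ p → ΣL-map (p ,_) Qs _) ⟩
    ΣL R Ps (λ p → ΣL R Qs (λ q → if isForest R n p q then forestWeight R n p q φ y else 0#))
      ≈⟨ ΣL-cong Ps ranks ⟩
    ΣL R Ps (λ p → if increasingFrom 0 p then pow R y (roots p) * Π< n (λ u → ψ (degree p u ℕ.+ 0)) else 0#)
      ≈⟨ parentSum-Parents ψ y n n 0 (λ _ → 0) ℕₚ.≤-refl ⟩
    parentSum ψ y n (range 0 n) (λ _ → 0)
      ≈⟨ reflexive (≡.cong (λ bs → parentSum ψ y n bs (λ _ → 0)) (range-parentBounds n)) ⟩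
    parentSum ψ y n (parentBounds n 0) (λ _ → 0)
      ≈⟨ parentSum-leafValue ψ y n 0 ⟩
    leafValue ψ y n 0 ∎
    where
    Ps : List (Parents n n)
    Ps = allVecs (nothing ∷ map just (allFin n)) n
    Qs : List (Vec (Fin n) n)
    Qs = allVecs (allFin n) n
    ψ : Seq
    ψ d = factorial d * φ d
    ranks : ∀ p → ΣL R Qs (λ q → if isForest R n p q then forestWeight R n p q φ y else 0#) ≈
      (if increasingFrom 0 p then pow R y (roots p) * Π< n (λ u → ψ (degree p u ℕ.+ 0)) else 0#)
    ranks p = begin
      ΣL R Qs (λ q → if isForest R n p q then forestWeight R n p q φ y else 0#)
        ≈⟨ ΣL-cong Qs (λ q → trans (if-cong (isForest R n p q) (forestWeight-degree n p q φ y) refl)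
             (reflexive (≡.cong (λ b → if b then W else 0#) (isForest-ranked n p q)))) ⟩
      ΣL R Qs (λ q → if increasingFrom 0 p ∧ ranked (initial p) p q then W else 0#)
        ≈⟨ ΣL-∧ Qs (increasingFrom 0 p) (ranked (initial p) p) (λ _ → W) ⟩
      (if increasingFrom 0 p then ΣL R Qs (λ q → if ranked (initial p) p q then W else 0#) else 0#)
        ≈⟨ if-cong (increasingFrom 0 p) (begin
             ΣL R Qs (λ q → if ranked (initial p) p q then W else 0#)
               ≈⟨ Σ-ranked n n p (initial p) W ℕₚ.≤-refl (initial-degree p) ⟩
             Π< n (factorial ∘ degree p) * (pow R y (roots p) * Π< n (φ ∘ degree p))
               ≈⟨ *-swap _ _ _ ⟩
             pow R y (roots p) * (Π< n (factorial ∘ degree p) * Π< n (φ ∘ degree p))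
               ≈⟨ *-congˡ (Π<-* n _ _) ⟩
             pow R y (roots p) * Π< n (λ u → ψ (degree p u))
               ≈⟨ *-congˡ (Π<-cong n (λ u _ → reflexive (≡.cong ψ (≡.sym (ℕₚ.+-identityʳ (degree p u)))))) ⟩
             pow R y (roots p) * Π< n (λ u → ψ (degree p u ℕ.+ 0)) ∎) refl ⟩
      (if increasingFrom 0 p then pow R y (roots p) * Π< n (λ u → ψ (degree p u ℕ.+ 0)) else 0#) ∎
      where
      W : Carrier
      W = pow R y (roots p) * Π< n (φ ∘ degree p)

  leafValue-cong : ∀ {ψ ψ′} y → (∀ d → ψ d ≈ ψ′ d) → ∀ n m → leafValue ψ y n m ≈ leafValue ψ′ y n m
  leafValue-cong y eq zero    m = refl
  leafValue-cong y eq (suc n) m = attach-cong eq (leafValue-cong y eq n) m 1 0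

theorem1p5 : ∀ {c ℓ} (R : CommutativeSemiring c ℓ) (r : ℕ) → r ≥ 1 →
    (x : Fin r → CommutativeSemiring.Carrier R) (y : CommutativeSemiring.Carrier R) (n : ℕ) →
    CommutativeSemiring._≈_ R (lah R (elem R r x) y n) (stieltjesRogers R r (alphaSeq R r x y) n)
theorem1p5 R r _ x y n = begin
  lah R (elem R r x) y n
    ≈⟨ lah-leafValue R (elem R r x) y n ⟩
  leafValue R (λ d → factorial R d * elem R r x d) y n 0
    ≈⟨ leafValue-cong R y (factorial-elem R r x) n 0 ⟩
  leafValue R (addDerivatives R r x (δ₀ R)) y n 0
    ≈⟨ leafValue-translate R r x y n 0 ⟩
  blockValue R r x y n 0
    ≈⟨ stieltjesRogers-blockValue R r x y n ⟨
  stieltjesRogers R r (alphaSeq R r x y) n ∎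
  where
  open CommutativeSemiring R using (_*_; setoid)
  open import Relation.Binary.Reasoning.Setoid setoid
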